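{- Let $n \ge 1$ be an integer, let $G$ be a bipartite graph, and let $F_1, \ldots, F_n$ be matchings in $G$, each of size at least $\lceil \frac{3}{2}n \rceil + 1$. Then there is a full rainbow matching for $F_1,\ldots,F_n$; that is, there exist pairwise disjoint edges $e_1, \ldots, e_n$ with $e_i \in F_i$ for every $i = 1, \ldots, n$. Equivalently, $f(n) \le \lceil \frac{3}{2}n \rceil + 1$.
   Context: Given sets $F_1,\ldots,F_n$ of edges in a graph, a rainbow matching is a matching consisting of edges chosen from distinct sets $F_i$ (at most one edge from each $F_i$); it is full if it contains an edge from every $F_i$. For a positive integer $n$, $f(n)$ denotes the least number such that any $n$ matchings $F_1,\ldots,F_n$ in a bipartite graph, each of size at least $f(n)$, have a full rainbow matching. -}

module Defs where

open import Data.Nat using (ℕ)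
open import Data.Fin using (Fin)
open import Data.Product using (_×_; proj₁; proj₂)
open import Data.List using (List)
open import Data.List.Membership.Propositional using (_∈_)
open import Data.List.Relation.Unary.All using (All)
open import Data.List.Relation.Unary.AllPairs using (AllPairs)
open import Relation.Binary.PropositionalEquality using (_≢_)

Edge : ℕ → ℕ → Set
Edge p q = Fin p × Fin q

BipGraph : ℕ → ℕ → Set₁
BipGraph p q = Edge p q → Set

Disjoint : ∀ {p q} → Edge p q → Edge p q → Set
Disjoint e f = (proj₁ e ≢ proj₁ f) × (proj₂ e ≢ proj₂ f)

-- a matching in G, given as a list of edges of G that are pairwise
-- disjoint (hence also pairwise distinct, so its size is its length)
IsMatching : ∀ {p q} → BipGraph p q → List (Edge p q) → Set
IsMatching G M = All G M × AllPairs Disjoint M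

{-# OPTIONS --safe #-}
module Submission where

open import Defs
open import Data.Nat using (ℕ; suc; _*_; _+_; _≤_; ⌈_/2⌉)
open import Data.Fin using (Fin)
open import Data.List using (List; length)
open import Data.List.Membership.Propositional using (_∈_)
open import Data.Product using (Σ; _×_)
open import Relation.Binary.PropositionalEquality using (_≢_)

open import Data.Bool using (Bool; true; false; not; if_then_else_; _∧_)
open import Data.Bool.Properties using (not-involutive; not-¬)
open import Data.Empty using (⊥; ⊥-elim)
open import Data.Fin using (zero; suc)
open import Data.Fin.Properties using (any?) renaming (_≟_ to _≟ᶠ_)
open import Data.List using ([]; _∷_; _++_; map; concatMap; filter; allFin; tabulate)
open import Data.List.Membership.Propositional using (_∉_; lose; find)
open import Data.List.Membership.Propositional.Properties using (∈-∃++; ∈-++⁺ˡ; ∈-++⁺ʳ; ∈-++⁻; ∈-filter⁻; ∈-filter⁺; ∈-allFin; ∈-concatMap⁺; ∈-map⁺; ∈-map⁻)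
import Data.List.Membership.DecPropositional as DecMembership
open import Data.List.Properties using (map-++; length-++; length-map; length-tabulate; ++-identityʳ)
open import Data.List.Relation.Binary.Permutation.Propositional as Perm using (_↭_; ↭-sym; ↭-trans)
open import Data.List.Relation.Binary.Permutation.Propositional.Properties using (All-resp-↭; ∈-resp-↭; shift; shifts; ++⁺ˡ; ++⁺ʳ; ++-assoc)
open import Data.List.Relation.Unary.All as All using (All; []; _∷_)
open import Data.List.Relation.Unary.All.Properties using (¬All⇒Any¬)
open import Data.List.Relation.Unary.AllPairs using (AllPairs; []; _∷_)
open import Data.List.Relation.Unary.Any as Any using (here; there)
open import Data.List.Relation.Unary.Unique.Propositional using (Unique)
open import Data.List.Relation.Unary.Unique.Propositional.Properties using (allFin⁺; filter⁺; map⁺; ++⁺)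
open import Data.Maybe as Maybe using (Maybe; just; nothing; maybe′)
open import Data.Maybe.Properties using (just-injective)
open import Data.Nat using (zero; _∸_; _<_; z≤n; s≤s; ⌊_/2⌋)
open import Data.Nat.ListAction using (sum)
open import Data.Nat.ListAction.Properties using (sum-++)
open import Data.Nat.Properties hiding (_≟_)
open import Data.Nat.Solver using (module +-*-Solver)
open import Data.Product using (∃; _,_; proj₁; proj₂)
open import Data.Sum using (_⊎_; inj₁; inj₂; [_,_]′)
open import Data.Sum.Properties using (inj₁-injective; inj₂-injective; ≡-dec)
open import Data.Unit using (⊤; tt)
open import Function using (_∘_; id; const)
open import Relation.Binary.Definitions using (DecidableEquality)
open import Relation.Binary.PropositionalEquality hiding (_≢_; [_])
open import Relation.Nullary using (¬_; Dec; yes; no; does)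
open import Relation.Nullary.Decidable using (map′; _×-dec_; _→-dec_; _⊎-dec_)
open import Relation.Unary using (Decidable)

-- By induction on n there is a rainbow matching R omitting a single colour c; assume that it cannot be
-- completed.  Some edges of R are kept ("out"); the vertices off the out edges are partitioned into gadgets,
-- where a gadget of size 3h + 1 hosts h colours in such a way that any one of its vertices can be avoided.
-- Initially R is out and the gadgets are single vertices.  No edge of F_c joins two gadgets, and if F_c joins
-- the two ends of an out edge to different gadgets, these can be merged along that edge, whose colour becomes
-- the missing one; so we may induct on the number of out edges.  If no merge is possible, then counting the
-- edges of F_c shows that F_c perfectly matches at least five gadgets ("full" ones).
--
-- A nontrivial gadget consists of a smaller one and of three vertices z, u true, u false hosting one further
-- colour e, which joins z to one u-vertex and the other u-vertex to the smaller gadget: two types.  If c is full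
-- there, then either R can be completed or c has the type opposite to e, and c can take the place of e.
-- Depth-first search along these exchanges: when c is full at an earlier gadget s of the search path, the
-- gadgets after s can be turned around, so both types become available there and F_c loses edges in them.
-- They are dead, and s is closed.  The loss from the dead gadgets makes the count exceed the number of
-- closed ones, so the search can always go on, which is absurd.

-- Sums over lists and duplicate-free lists.

[_]ᵇ : {P : Set} → Dec P → ℕ
[ p ]ᵇ = if does p then 1 else 0

module _ {P C : Set} {x y : C} where

  if-yes : (p? : Dec P) → P → (if does p? then x else y) ≡ x
  if-yes (yes _) _ = refl
  if-yes (no ¬p) p = ⊥-elim (¬p p)

  if-no : (p? : Dec P) → ¬ P → (if does p? then x else y) ≡ y
  if-no (yes p) ¬p = ⊥-elim (¬p p)
  if-no (no _)  _  = refl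

module _ {A : Set} where

  Σ[_] : List A → (A → ℕ) → ℕ
  Σ[ xs ] f = sum (map f xs)

  Σ-mono : ∀ xs {f g : A → ℕ} → (∀ {x} → x ∈ xs → f x ≤ g x) → Σ[ xs ] f ≤ Σ[ xs ] g
  Σ-mono []       f≤g = z≤n
  Σ-mono (x ∷ xs) f≤g = +-mono-≤ (f≤g (here refl)) (Σ-mono xs (f≤g ∘ there))

  Σ-cong : ∀ xs {f g : A → ℕ} → (∀ {x} → x ∈ xs → f x ≡ g x) → Σ[ xs ] f ≡ Σ[ xs ] g
  Σ-cong []       f≡g = refl
  Σ-cong (x ∷ xs) f≡g = cong₂ _+_ (f≡g (here refl)) (Σ-cong xs (f≡g ∘ there))

  Σ-++ : ∀ xs ys (f : A → ℕ) → Σ[ xs ++ ys ] f ≡ Σ[ xs ] f + Σ[ ys ] f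
  Σ-++ xs ys f = trans (cong sum (map-++ f xs ys)) (sum-++ (map f xs) (map f ys))

  Σ-+ : ∀ xs (f g : A → ℕ) → Σ[ xs ] (λ x → f x + g x) ≡ Σ[ xs ] f + Σ[ xs ] g
  Σ-+ []       f g = refl
  Σ-+ (x ∷ xs) f g = begin
    f x + g x + Σ[ xs ] (λ y → f y + g y)   ≡⟨ cong (f x + g x +_) (Σ-+ xs f g) ⟩
    f x + g x + (Σ[ xs ] f + Σ[ xs ] g)     ≡⟨ +-assoc (f x) (g x) _ ⟩
    f x + (g x + (Σ[ xs ] f + Σ[ xs ] g))   ≡⟨ cong (f x +_) (sym (+-assoc (g x) (Σ[ xs ] f) _)) ⟩
    f x + (g x + Σ[ xs ] f + Σ[ xs ] g)     ≡⟨ cong (λ k → f x + (k + Σ[ xs ] g)) (+-comm (g x) _) ⟩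
    f x + (Σ[ xs ] f + g x + Σ[ xs ] g)     ≡⟨ cong (f x +_) (+-assoc (Σ[ xs ] f) (g x) _) ⟩
    f x + (Σ[ xs ] f + (g x + Σ[ xs ] g))   ≡⟨ sym (+-assoc (f x) (Σ[ xs ] f) _) ⟩
    f x + Σ[ xs ] f + (g x + Σ[ xs ] g)     ∎
    where open ≡-Reasoning

  Σ-* : ∀ xs k (f : A → ℕ) → Σ[ xs ] (λ x → k * f x) ≡ k * Σ[ xs ] f
  Σ-* []       k f = sym (*-zeroʳ k)
  Σ-* (x ∷ xs) k f = trans (cong (k * f x +_) (Σ-* xs k f)) (sym (*-distribˡ-+ k (f x) _))

  Σ-const : ∀ xs k → Σ[ xs ] (λ _ → k) ≡ k * length xs
  Σ-const []       k = sym (*-zeroʳ k)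
  Σ-const (x ∷ xs) k = trans (cong (k +_) (Σ-const xs k)) (sym (*-suc k (length xs)))

  Σ-⊆ : ∀ {xs ys} (f : A → ℕ) → Unique xs → (∀ {x} → x ∈ xs → x ∈ ys) → Σ[ xs ] f ≤ Σ[ ys ] f
  Σ-⊆ {[]}     f []          _     = z≤n
  Σ-⊆ {x ∷ xs} f (x∉xs ∷ u) xs⊆ys with ∈-∃++ (xs⊆ys (here refl))
  ... | us , vs , refl = begin
    f x + Σ[ xs ] f                 ≤⟨ +-monoʳ-≤ (f x) (Σ-⊆ f u rest) ⟩
    f x + Σ[ us ++ vs ] f           ≡⟨ cong (f x +_) (Σ-++ us vs f) ⟩
    f x + (Σ[ us ] f + Σ[ vs ] f)   ≡⟨ sym (+-assoc (f x) (Σ[ us ] f) _) ⟩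
    f x + Σ[ us ] f + Σ[ vs ] f     ≡⟨ cong (_+ Σ[ vs ] f) (+-comm (f x) _) ⟩
    Σ[ us ] f + f x + Σ[ vs ] f     ≡⟨ +-assoc (Σ[ us ] f) (f x) _ ⟩
    Σ[ us ] f + Σ[ x ∷ vs ] f       ≡⟨ sym (Σ-++ us (x ∷ vs) f) ⟩
    Σ[ us ++ x ∷ vs ] f             ∎
    where
    open ≤-Reasoning
    rest : ∀ {y} → y ∈ xs → y ∈ us ++ vs
    rest y∈xs with ∈-++⁻ us (xs⊆ys (there y∈xs))
    ... | inj₁ y∈us           = ∈-++⁺ˡ y∈us
    ... | inj₂ (there y∈vs)   = ∈-++⁺ʳ us y∈vs
    ... | inj₂ (here refl)    = ⊥-elim (All.lookup x∉xs y∈xs refl)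

  length-⊆ : ∀ {xs ys : List A} → Unique xs → (∀ {x} → x ∈ xs → x ∈ ys) → length xs ≤ length ys
  length-⊆ {xs} {ys} u xs⊆ys =
    subst₂ _≤_ (trans (Σ-const xs 1) (*-identityˡ _)) (trans (Σ-const ys 1) (*-identityˡ _))
      (Σ-⊆ (const 1) u xs⊆ys)

  Σ-filter : ∀ {P : A → Set} (P? : Decidable P) xs → Σ[ xs ] (λ x → [ P? x ]ᵇ) ≡ length (filter P? xs)
  Σ-filter P? []       = refl
  Σ-filter P? (x ∷ xs) with P? x
  ... | yes _ = cong suc (Σ-filter P? xs)
  ... | no  _ = Σ-filter P? xs

  Σ-concatMap : ∀ {B : Set} (g : B → List A) xs (f : A → ℕ) →
                Σ[ concatMap g xs ] f ≡ sum (map (λ x → Σ[ g x ] f) xs)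
  Σ-concatMap g []       f = refl
  Σ-concatMap g (x ∷ xs) f = trans (Σ-++ (g x) (concatMap g xs) f) (cong (Σ[ g x ] f +_) (Σ-concatMap g xs f))

  Σ-only : ∀ {xs} (f : A → ℕ) {x} → Unique xs → x ∈ xs → (∀ {y} → y ≢ x → f y ≡ 0) → Σ[ xs ] f ≡ f x
  Σ-only f {x} (y∉ ∷ u) (here refl) f0 = trans (cong (f x +_) (zeros _ y∉)) (+-identityʳ _)
    where
    zeros : ∀ ys → All (x ≢_) ys → Σ[ ys ] f ≡ 0
    zeros []       []       = refl
    zeros (y ∷ ys) (p ∷ ps) = cong₂ _+_ (f0 (p ∘ sym)) (zeros ys ps)
  Σ-only f (y∉ ∷ u) (there x∈) f0 = cong₂ _+_ (f0 (All.lookup y∉ x∈)) (Σ-only f u x∈ f0)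

  -- `R` will be `Rainbow`: a finite family of attempts either succeeds once or leaves the
  -- obstruction at every member. This replaces a proof by contradiction.
  collect : ∀ {R : Set} {P : A → Set} xs → (∀ {x} → x ∈ xs → R ⊎ P x) → R ⊎ (∀ {x} → x ∈ xs → P x)
  collect []       f = inj₂ λ ()
  collect (x ∷ xs) f with f (here refl) | collect xs (f ∘ there)
  ... | inj₁ r | _      = inj₁ r
  ... | inj₂ _ | inj₁ r = inj₁ r
  ... | inj₂ p | inj₂ q = inj₂ λ { (here refl) → p ; (there x∈) → q x∈ }

  Unique-++⁻ : ∀ xs {ys : List A} → Unique (xs ++ ys) →
               Unique xs × Unique ys × (∀ {x} → x ∈ xs → x ∉ ys)
  Unique-++⁻ []       u        = [] , u , λ ()
  Unique-++⁻ (x ∷ xs) (x∉ ∷ u) with Unique-++⁻ xs u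
  ... | uxs , uys , disj =
    All.tabulate (λ y∈ → All.lookup x∉ (∈-++⁺ˡ y∈)) ∷ uxs , uys ,
    λ { (here refl) x∈ys → All.lookup x∉ (∈-++⁺ʳ xs x∈ys) refl ; (there y∈) → disj y∈ }

  Unique-resp-↭ : ∀ {xs ys : List A} → xs ↭ ys → Unique xs → Unique ys
  Unique-resp-↭ Perm.refl u = u
  Unique-resp-↭ (Perm.prep _ p) (x∉ ∷ u) = All-resp-↭ p x∉ ∷ Unique-resp-↭ p u
  Unique-resp-↭ (Perm.swap _ _ p) ((x≢y ∷ x∉) ∷ y∉ ∷ u) =
    ((x≢y ∘ sym) ∷ All-resp-↭ p y∉) ∷ All-resp-↭ p x∉ ∷ Unique-resp-↭ p u
  Unique-resp-↭ (Perm.trans p q) u = Unique-resp-↭ q (Unique-resp-↭ p u)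

-- Rainbow matchings within a set of vertices.

Disj : {V : Set} → V × V → V × V → Set
Disj (u , v) (x , y) = (u ≢ x × u ≢ y) × (v ≢ x × v ≢ y)

-- The matchings appear twice: as partial involutions `mate i` on the vertices, and as lists `es i`,
-- through which the hypothesis on their sizes enters.
module Core
  (V : Set) (_≟_ : DecidableEquality V) (vs : List V) (vs-all : ∀ v → v ∈ vs) (vs-unique : Unique vs)
  (side : V → Bool) (n : ℕ) (mate : Fin n → V → Maybe V)
  (mate-sym : ∀ {i u v} → mate i u ≡ just v → mate i v ≡ just u)
  (mate-side : ∀ {i u v} → mate i u ≡ just v → side v ≡ not (side u))
  (es : Fin n → List (V × V))
  (es-joined : ∀ {i e} → e ∈ es i → mate i (proj₁ e) ≡ just (proj₂ e))
  (es-unique : ∀ i → Unique (concatMap (λ e → proj₁ e ∷ proj₂ e ∷ []) (es i)))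
  (es-size : ∀ i → 3 * n + 2 ≤ 2 * length (es i))
  where

  open DecMembership _≟_ using (_∈?_)

  Rainbow : Set
  Rainbow = Σ (Fin n → V × V) λ e →
    (∀ i → mate i (proj₁ (e i)) ≡ just (proj₂ (e i))) × (∀ i j → i ≢ j → Disj (e i) (e j))

  opposite-≢ : ∀ {u v} → side v ≡ not (side u) → u ≢ v
  opposite-≢ eq refl = not-¬ refl eq

  -- Edges are indexed by proofs of `Γ i`, as `Γ` need not be decidable. Two proofs for the same
  -- colour may give different edges, so `apart` speaks of distinct colours only.
  record Host (S : V → Set) (Γ : Fin n → Set) (X : V → Set) : Set where
    field
      edge   : ∀ {i} → Γ i → V × V
      joined : ∀ {i} (γ : Γ i) → mate i (proj₁ (edge γ)) ≡ just (proj₂ (edge γ))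
      inside : ∀ {i} (γ : Γ i) → S (proj₁ (edge γ)) × S (proj₂ (edge γ))
      avoids : ∀ {i} (γ : Γ i) → ¬ X (proj₁ (edge γ)) × ¬ X (proj₂ (edge γ))
      apart  : ∀ {i j} (γ : Γ i) (δ : Γ j) → i ≢ j → Disj (edge γ) (edge δ)

  open Host

  no-host : ∀ {S Γ X} → (∀ {i} → ¬ Γ i) → Host S Γ X
  no-host ¬Γ = record
    { edge = λ γ → ⊥-elim (¬Γ γ) ; joined = λ γ → ⊥-elim (¬Γ γ) ; inside = λ γ → ⊥-elim (¬Γ γ)
    ; avoids = λ γ → ⊥-elim (¬Γ γ) ; apart = λ γ → ⊥-elim (¬Γ γ) }

  avoid : ∀ {S Γ X Y} → (∀ {v} → S v → Y v → X v) → Host S Γ X → Host S Γ Y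
  avoid sub H = record
    { edge = edge H ; joined = joined H ; inside = inside H ; apart = apart H
    ; avoids = λ γ → proj₁ (avoids H γ) ∘ sub (proj₁ (inside H γ))
                   , proj₂ (avoids H γ) ∘ sub (proj₂ (inside H γ)) }

  -- Here `clash` makes the host inside `T` keep clear of the new edge as well as of `X`.
  add-edge : ∀ {S T Γ Δ X Y d p q} → Host T Δ Y → (∀ {v} → T v → S v) →
             mate d p ≡ just q → S p → S q → ¬ X p → ¬ X q →
             (∀ {v} → T v → v ≡ p ⊎ v ≡ q ⊎ X v → Y v) →
             (∀ {i} → Γ i → Δ i ⊎ i ≡ d) → Host S Γ X
  add-edge {S} {T} {Γ} {Δ} {X} {Y} {d} {p} {q} H T⊆S pq Sp Sq ¬Xp ¬Xq clash split = record
    { edge   = λ γ → edge′ (split γ)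
    ; joined = λ γ → joined′ (split γ)
    ; inside = λ γ → inside′ (split γ)
    ; avoids = λ γ → avoids′ (split γ)
    ; apart  = λ γ δ → apart′ (split γ) (split δ)
    }
    where
    edge′ : ∀ {i} → Δ i ⊎ i ≡ d → V × V
    edge′ (inj₁ δ) = edge H δ
    edge′ (inj₂ _) = p , q

    joined′ : ∀ {i} (γ : Δ i ⊎ i ≡ d) → mate i (proj₁ (edge′ γ)) ≡ just (proj₂ (edge′ γ))
    joined′ (inj₁ δ)    = joined H δ
    joined′ (inj₂ refl) = pq

    inside′ : ∀ {i} (γ : Δ i ⊎ i ≡ d) → S (proj₁ (edge′ γ)) × S (proj₂ (edge′ γ))
    inside′ (inj₁ δ) = T⊆S (proj₁ (inside H δ)) , T⊆S (proj₂ (inside H δ))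
    inside′ (inj₂ _) = Sp , Sq

    clear : ∀ {i} (δ : Δ i) {P : V → Set} → (∀ {v} → T v → P v → Y v) →
            ¬ P (proj₁ (edge H δ)) × ¬ P (proj₂ (edge H δ))
    clear δ f = proj₁ (avoids H δ) ∘ f (proj₁ (inside H δ)) , proj₂ (avoids H δ) ∘ f (proj₂ (inside H δ))

    avoids′ : ∀ {i} (γ : Δ i ⊎ i ≡ d) → ¬ X (proj₁ (edge′ γ)) × ¬ X (proj₂ (edge′ γ))
    avoids′ (inj₁ δ) = clear δ λ t x → clash t (inj₂ (inj₂ x))
    avoids′ (inj₂ _) = ¬Xp , ¬Xq

    apart′ : ∀ {i j} (γ : Δ i ⊎ i ≡ d) (δ : Δ j ⊎ j ≡ d) → i ≢ j → Disj (edge′ γ) (edge′ δ)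
    apart′ (inj₁ γ)    (inj₁ δ)    i≢j = apart H γ δ i≢j
    apart′ (inj₂ refl) (inj₂ refl) i≢j = ⊥-elim (i≢j refl)
    apart′ (inj₁ γ)    (inj₂ _)    _   =
      let p₁ , p₂ = clear γ λ t e → clash t (inj₁ e)
          q₁ , q₂ = clear γ λ t e → clash t (inj₂ (inj₁ e))
      in (p₁ , q₁) , (p₂ , q₂)
    apart′ (inj₂ _)    (inj₁ δ)    _   =
      let p₁ , p₂ = clear δ λ t e → clash t (inj₁ e)
          q₁ , q₂ = clear δ λ t e → clash t (inj₂ (inj₁ e))
      in (p₁ ∘ sym , p₂ ∘ sym) , (q₁ ∘ sym , q₂ ∘ sym)

  -- Gadgets.

  -- Gad S Γ h: the 3h + 1 vertices of S host the h colours of Γ.  Every vertex w has to lie in the smaller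
  -- gadget T of some decomposition, for otherwise merging would not preserve the decompositions.
  mutual
    data Gad (S : V → Set) (Γ : Fin n → Set) : ℕ → Set₁ where
      single : (∀ {u v} → S u → S v → u ≡ v) → (∀ {i} → ¬ Γ i) → Gad S Γ 0
      node   : ∀ {h w} → S w → (∀ {w} → S w → Slot S Γ h w) → Gad S Γ (suc h)

    record Frame (S : V → Set) (h : ℕ) : Set₁ where
      inductive
      field
        z      : V
        u      : Bool → V
        T      : V → Set
        Δ      : Fin n → Set
        core   : Gad T Δ h
        T⊆S    : ∀ {v} → T v → S v
        Sz     : S z
        Su     : ∀ β → S (u β)
        split  : ∀ {v} → S v → T v ⊎ v ≡ z ⊎ ∃ λ β → v ≡ u β
        z∉T    : ¬ T z
        u∉T    : ∀ β → ¬ T (u β)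
        u-side : ∀ β → side (u β) ≡ not (side z)
        u-dist : u true ≢ u false

    -- `β` is the type of `e`. A frame leaves this colour open, so that colours can be exchanged
    -- later.
    Good : ∀ {S h} → Frame S h → Fin n → Bool → Set
    Good f e β = mate e z ≡ just (u β) × ∃ λ t → T t × mate e (u (not β)) ≡ just t
      where open Frame f

    record Slot (S : V → Set) (Γ : Fin n → Set) (h : ℕ) (w : V) : Set₁ where
      inductive
      field
        frame  : Frame S h
        w∈T    : Frame.T frame w
        d      : Fin n
        β      : Bool
        good   : Good frame d β
        colours : ∀ {i} → Γ i → Frame.Δ frame i ⊎ i ≡ d

  -- The slot chosen for the vertex to be avoided has it in `T`. By induction the core avoids it,
  -- and the edge of `d` between `z` and `u β` lies off `T`.
  flex : ∀ {S Γ h u} → Gad S Γ h → S u → Host S Γ (_≡ u)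
  flex (single _ ¬Γ)   _  = no-host ¬Γ
  flex {S} {u = w} (node _ slots) Sw =
    add-edge (flex core w∈T) T⊆S (proj₁ good) Sz (Su β) (λ eq → z∉T (subst T (sym eq) w∈T))
      (λ eq → u∉T β (subst T (sym eq) w∈T))
      (λ { t (inj₁ refl) → ⊥-elim (z∉T t) ; t (inj₂ (inj₁ refl)) → ⊥-elim (u∉T β t) ; t (inj₂ (inj₂ e)) → e })
      colours
    where
    open Slot (slots Sw)
    open Frame frame

  any-host : ∀ {S Γ h X} → Gad S Γ h → (∀ {v} → S v → ¬ X v) → Host S Γ X
  any-host (single _ ¬Γ)       _   = no-host ¬Γ
  any-host G@(node Sw _) S#X = avoid (λ s x → ⊥-elim (S#X s x)) (flex G Sw)

  vertices : ∀ {S Γ h w} → Gad S Γ h → S w →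
             Σ (List V) λ xs → (∀ {v} → v ∈ xs → S v) × (∀ {v} → S v → v ∈ xs) × length xs ≡ 3 * h + 1
  vertices {w = w} (single eq _) Sw = w ∷ [] , (λ { (here refl) → Sw }) , (λ s → here (eq s Sw)) , refl
  vertices {S} (node {h} _ slots) Sw = xs′ , ⊆S , S⊆ , trans (cong (3 +_) len) (sym (cong (_+ 1) (*-suc 3 h)))
    where
    open Slot (slots Sw)
    open Frame frame
    IH = vertices core w∈T
    xs = proj₁ IH
    len = proj₂ (proj₂ (proj₂ IH))
    xs′ = z ∷ u true ∷ u false ∷ xs
    ⊆S : ∀ {v} → v ∈ xs′ → S v
    ⊆S (here refl)                 = Sz
    ⊆S (there (here refl))         = Su true
    ⊆S (there (there (here refl))) = Su false
    ⊆S (there (there (there v∈)))  = T⊆S (proj₁ (proj₂ IH) v∈)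
    S⊆ : ∀ {v} → S v → v ∈ xs′
    S⊆ s with split s
    ... | inj₁ t                   = there (there (there (proj₁ (proj₂ (proj₂ IH)) t)))
    ... | inj₂ (inj₁ e)            = here e
    ... | inj₂ (inj₂ (true , e))   = there (here e)
    ... | inj₂ (inj₂ (false , e))  = there (there (here e))

  Gad-map : ∀ {S S′ Γ Γ′ h} → (∀ {v} → S v → S′ v) → (∀ {v} → S′ v → S v) → (∀ {i} → Γ′ i → Γ i) →
            Gad S Γ h → Gad S′ Γ′ h
  Gad-map to from fromΓ (single eq ¬Γ)  = single (λ s t → eq (from s) (from t)) (¬Γ ∘ fromΓ)
  Gad-map {S} {S′} {Γ} {Γ′} to from fromΓ (node {h} Sw slots) = node (to Sw) (slot ∘ slots ∘ from)
    where
    slot : ∀ {w} → Slot S Γ h w → Slot S′ Γ′ h w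
    slot sl = record
      { frame = record
        { z = z ; u = u ; T = T ; Δ = Δ ; core = core ; T⊆S = to ∘ T⊆S ; Sz = to Sz ; Su = to ∘ Su
        ; split = split ∘ from ; z∉T = z∉T ; u∉T = u∉T ; u-side = u-side ; u-dist = u-dist }
      ; w∈T = w∈T ; d = d ; β = β ; good = good ; colours = colours ∘ fromΓ }
      where
      open Slot sl
      open Frame frame

  -- Merging two gadgets.

  -- The path x, b, a, y along which two gadgets are merged; ab is an out edge.
  record Bridge (S₁ S₂ : V → Set) (c : Fin n) : Set where
    field
      x b a y : V
      Sx      : S₁ x
      Sy      : S₂ y
      bx      : mate c b ≡ just x
      ay      : mate c a ≡ just y
      ab      : side b ≡ not (side a)
      disj    : ∀ {v} → S₁ v → ¬ S₂ v
      a∉₁     : ¬ S₁ a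
      a∉₂     : ¬ S₂ a
      b∉₁     : ¬ S₁ b
      b∉₂     : ¬ S₂ b

  flip : ∀ {S₁ S₂ c} → Bridge S₁ S₂ c → Bridge S₂ S₁ c
  flip br = record
    { x = y ; b = a ; a = b ; y = x ; Sx = Sy ; Sy = Sx ; bx = ay ; ay = bx
    ; ab = sym (trans (cong not ab) (not-involutive (side a)))
    ; disj = λ s t → disj t s ; a∉₁ = b∉₂ ; a∉₂ = b∉₁ ; b∉₁ = a∉₂ ; b∉₂ = a∉₁ }
    where open Bridge br

  -- Sets are predicates, so the union is described by inclusions and `S` may be any equivalent
  -- predicate. For colours one inclusion suffices, since hosting fewer colours is easier.
  record Union (S₁ S₂ : V → Set) (p q : V) (Γ₁ Γ₂ : Fin n → Set) (c : Fin n)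
               (S : V → Set) (Γ : Fin n → Set) : Set where
    field
      into  : ∀ {v} → S v → S₁ v ⊎ S₂ v ⊎ v ≡ p ⊎ v ≡ q
      from₁ : ∀ {v} → S₁ v → S v
      from₂ : ∀ {v} → S₂ v → S v
      from-p : S p
      from-q : S q
      intoΓ : ∀ {i} → Γ i → Γ₁ i ⊎ Γ₂ i ⊎ i ≡ c

  flipᵁ : ∀ {S₁ S₂ p q Γ₁ Γ₂ c S Γ} → Union S₁ S₂ p q Γ₁ Γ₂ c S Γ → Union S₂ S₁ q p Γ₂ Γ₁ c S Γ
  flipᵁ U = record
    { into = λ s → [ inj₂ ∘ inj₁ , [ inj₁ , [ inj₂ ∘ inj₂ ∘ inj₂ , inj₂ ∘ inj₂ ∘ inj₁ ]′ ]′ ]′ (into s)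
    ; from₁ = from₂ ; from₂ = from₁ ; from-p = from-q ; from-q = from-p
    ; intoΓ = λ γ → [ inj₂ ∘ inj₁ , [ inj₁ , inj₂ ∘ inj₂ ]′ ]′ (intoΓ γ) }
    where open Union U

  -- The sum of the sizes is named `k`, so that the recursive instance of `merge` can be handed to
  -- `far-slot` as an argument.
  Merge : ℕ → Set₁
  Merge k = ∀ {S₁ S₂ Γ₁ Γ₂ h₁ h₂ c S Γ} → h₁ + h₂ ≡ k → Gad S₁ Γ₁ h₁ → Gad S₂ Γ₂ h₂ →
            (br : Bridge S₁ S₂ c) → Union S₁ S₂ (Bridge.a br) (Bridge.b br) Γ₁ Γ₂ c S Γ → Gad S Γ (suc k)

  module _ {S₁ S₂ Γ₁ Γ₂ c S Γ} (br : Bridge S₁ S₂ c)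
           (un : Union S₁ S₂ (Bridge.a br) (Bridge.b br) Γ₁ Γ₂ c S Γ) where
    open Bridge br
    open Union un

    -- With `S₂` reduced to `y`, the new vertices are `a`, `b` and `y`. The core is `S₁`, and `c` is
    -- added through its edges `ay` and `bx`.
    leaf-slot : ∀ {h w} → Gad S₁ Γ₁ h → (∀ {u v} → S₂ u → S₂ v → u ≡ v) → (∀ {i} → ¬ Γ₂ i) →
                S₁ w → Slot S Γ h w
    leaf-slot G₁ eq₂ ¬Γ₂ w∈ = record
      { frame = record
        { z = a ; u = λ β → if β then y else b ; T = S₁ ; Δ = Γ₁ ; core = G₁ ; T⊆S = from₁
        ; Sz = from-p ; Su = λ { true → from₂ Sy ; false → from-q }
        ; split = λ s → sp (into s)
        ; z∉T = a∉₁ ; u∉T = λ { true s → disj s Sy ; false → b∉₁ }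
        ; u-side = λ { true → mate-side ay ; false → ab }
        ; u-dist = λ { refl → b∉₂ Sy } }
      ; w∈T = w∈ ; d = c ; β = true ; good = ay , x , Sx , bx
      ; colours = λ γ → [ inj₁ , [ (λ γ₂ → ⊥-elim (¬Γ₂ γ₂)) , inj₂ ]′ ]′ (intoΓ γ) }
      where
      sp : ∀ {v} → S₁ v ⊎ S₂ v ⊎ v ≡ a ⊎ v ≡ b → S₁ v ⊎ v ≡ a ⊎ ∃ λ β → v ≡ (if β then y else b)
      sp (inj₁ s)                = inj₁ s
      sp (inj₂ (inj₁ s))         = inj₂ (inj₂ (true , eq₂ s Sy))
      sp (inj₂ (inj₂ (inj₁ e)))  = inj₂ (inj₁ e)
      sp (inj₂ (inj₂ (inj₂ e)))  = inj₂ (inj₂ (false , e))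

    -- The path is all of `S`. To have `a` in the core, the core is `a` alone and `z` is `x`; then
    -- `c` joins `x` to `b` and `y` to `a`.
    middle-slot : (∀ {u v} → S₁ u → S₁ v → u ≡ v) → (∀ {i} → ¬ Γ₁ i) →
                  (∀ {u v} → S₂ u → S₂ v → u ≡ v) → (∀ {i} → ¬ Γ₂ i) → Slot S Γ 0 a
    middle-slot eq₁ ¬Γ₁ eq₂ ¬Γ₂ = record
      { frame = record
        { z = x ; u = λ β → if β then b else y ; T = _≡ a ; Δ = λ _ → ⊥
        ; core = single (λ { refl refl → refl }) (λ ()) ; T⊆S = λ { refl → from-p }
        ; Sz = from₁ Sx ; Su = λ { true → from-q ; false → from₂ Sy }
        ; split = λ s → sp (into s)
        ; z∉T = λ { refl → a∉₁ Sx }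
        ; u∉T = λ { true e → opposite-≢ ab (sym e) ; false refl → a∉₂ Sy }
        ; u-side = λ { true → mate-side (mate-sym bx) ; false → trans (mate-side ay) (trans (sym ab) (mate-side (mate-sym bx))) }
        ; u-dist = λ e → b∉₂ (subst S₂ (sym e) Sy) }
      ; w∈T = refl ; d = c ; β = true ; good = mate-sym bx , a , refl , mate-sym ay
      ; colours = λ γ → [ (λ γ₁ → ⊥-elim (¬Γ₁ γ₁)) , [ (λ γ₂ → ⊥-elim (¬Γ₂ γ₂)) , inj₂ ]′ ]′ (intoΓ γ) }
      where
      sp : ∀ {v} → S₁ v ⊎ S₂ v ⊎ v ≡ a ⊎ v ≡ b → v ≡ a ⊎ v ≡ x ⊎ ∃ λ β → v ≡ (if β then b else y)
      sp (inj₁ s)                = inj₂ (inj₁ (eq₁ s Sx))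
      sp (inj₂ (inj₁ s))         = inj₂ (inj₂ (false , eq₂ s Sy))
      sp (inj₂ (inj₂ (inj₁ e)))  = inj₁ e
      sp (inj₂ (inj₂ (inj₂ e)))  = inj₂ (inj₂ (true , e))

    -- The slot of `S₂` with `y` in its core survives: the bridge ends in that core, so only the
    -- core is merged with `S₁`. The new core contains `S₁`, `a` and `b`.
    far-slot : ∀ {k h₁ h₂ w} → Merge k → h₁ + h₂ ≡ k → Gad S₁ Γ₁ h₁ → Slot S₂ Γ₂ h₂ y →
               S₁ w ⊎ w ≡ a ⊎ w ≡ b → Slot S Γ (suc k) w
    far-slot {w = w} merge eq G₁ slot w∈ = record
      { frame = record
        { z = z ; u = u ; T = T′ ; Δ = Δ′ ; core = merge eq G₁ core br′ un′
        ; T⊆S = T′⊆S ; Sz = from₂ Sz ; Su = from₂ ∘ Su ; split = λ s → sp (into s)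
        ; z∉T = out z∉T Sz ; u∉T = λ β → out (u∉T β) (Su β) ; u-side = u-side ; u-dist = u-dist }
      ; w∈T = [ inj₁ , inj₂ ∘ inj₂ ]′ w∈ ; d = d ; β = β
      ; good = proj₁ good , proj₁ (proj₂ good) , inj₂ (inj₁ (proj₁ (proj₂ (proj₂ good)))) , proj₂ (proj₂ (proj₂ good))
      ; colours = λ γ → cs (intoΓ γ) }
      where
      open Slot slot
      open Frame frame
      T′ : V → Set
      T′ v = S₁ v ⊎ T v ⊎ v ≡ a ⊎ v ≡ b
      Δ′ : Fin n → Set
      Δ′ i = Γ₁ i ⊎ Δ i ⊎ i ≡ c
      br′ : Bridge S₁ T c
      br′ = record { x = x ; b = b ; a = a ; y = y ; Sx = Sx ; Sy = w∈T ; bx = bx ; ay = ay ; ab = ab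
                   ; disj = λ s t → disj s (T⊆S t) ; a∉₁ = a∉₁ ; a∉₂ = a∉₂ ∘ T⊆S ; b∉₁ = b∉₁ ; b∉₂ = b∉₂ ∘ T⊆S }
      un′ : Union S₁ T a b Γ₁ Δ c T′ Δ′
      un′ = record { into = id ; from₁ = inj₁ ; from₂ = inj₂ ∘ inj₁ ; from-p = inj₂ (inj₂ (inj₁ refl))
                   ; from-q = inj₂ (inj₂ (inj₂ refl)) ; intoΓ = id }
      T′⊆S : ∀ {v} → T′ v → S v
      T′⊆S (inj₁ s)                   = from₁ s
      T′⊆S (inj₂ (inj₁ t))            = from₂ (T⊆S t)
      T′⊆S (inj₂ (inj₂ (inj₁ refl)))  = from-p
      T′⊆S (inj₂ (inj₂ (inj₂ refl)))  = from-q
      sp : ∀ {v} → S₁ v ⊎ S₂ v ⊎ v ≡ a ⊎ v ≡ b → T′ v ⊎ v ≡ z ⊎ ∃ λ β → v ≡ u β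
      sp (inj₁ s)         = inj₁ (inj₁ s)
      sp (inj₂ (inj₂ e))  = inj₁ (inj₂ (inj₂ e))
      sp (inj₂ (inj₁ s)) with split s
      ... | inj₁ t = inj₁ (inj₂ (inj₁ t))
      ... | inj₂ r = inj₂ r
      out : ∀ {v} → ¬ T v → S₂ v → ¬ T′ v
      out ¬t s (inj₁ s₁)                  = disj s₁ s
      out ¬t s (inj₂ (inj₁ t))            = ¬t t
      out ¬t s (inj₂ (inj₂ (inj₁ refl)))  = a∉₂ s
      out ¬t s (inj₂ (inj₂ (inj₂ refl)))  = b∉₂ s
      cs : ∀ {i} → Γ₁ i ⊎ Γ₂ i ⊎ i ≡ c → Δ′ i ⊎ i ≡ d
      cs (inj₁ γ)         = inj₁ (inj₁ γ)
      cs (inj₂ (inj₂ e))  = inj₁ (inj₂ (inj₂ e))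
      cs (inj₂ (inj₁ γ)) with colours γ
      ... | inj₁ δ = inj₁ (inj₂ (inj₁ δ))
      ... | inj₂ e = inj₂ e

  -- If a vertex lies off a nontrivial gadget, that gadget is replaced by its core and the recursion
  -- applies. The other cases are a single vertex opposite the gadget of `w`, or two single
  -- vertices.
  merge : ∀ k → Merge k
  merge k {S₁} {S₂} {Γ₁} {Γ₂} {c = c} {S} {Γ} eq G₁ G₂ br un = node (from₁ Sx) (λ s → slot k eq G₁ G₂ (into s))
    where
    open Bridge br
    open Union un
    slot : ∀ k {h₁ h₂ w} → h₁ + h₂ ≡ k → Gad S₁ Γ₁ h₁ → Gad S₂ Γ₂ h₂ →
           S₁ w ⊎ S₂ w ⊎ w ≡ a ⊎ w ≡ b → Slot S Γ k w
    slot k {h₁} eq G₁ (single eq₂ ¬Γ₂) (inj₁ w∈) =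
      leaf-slot br un (subst (Gad S₁ Γ₁) (trans (sym (+-identityʳ h₁)) eq) G₁) eq₂ ¬Γ₂ w∈
    slot k eq (single eq₁ ¬Γ₁) G₂ (inj₂ (inj₁ w∈)) =
      leaf-slot (flip br) (flipᵁ un) (subst (Gad S₂ Γ₂) eq G₂) eq₁ ¬Γ₁ w∈
    slot zero refl (single eq₁ ¬Γ₁) (single eq₂ ¬Γ₂) (inj₂ (inj₂ (inj₁ refl))) =
      middle-slot br un eq₁ ¬Γ₁ eq₂ ¬Γ₂
    slot zero refl (single eq₁ ¬Γ₁) (single eq₂ ¬Γ₂) (inj₂ (inj₂ (inj₂ refl))) =
      middle-slot (flip br) (flipᵁ un) eq₂ ¬Γ₂ eq₁ ¬Γ₁
    slot zero {suc _} () (node _ _) _ _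
    slot zero {zero} () (single _ _) (node _ _) _
    slot (suc k) {h₁} eq G₁ (node {h} _ slots₂) (inj₁ w∈) =
      far-slot br un (merge k) (suc-injective (trans (sym (+-suc h₁ h)) eq)) G₁ (slots₂ Sy) (inj₁ w∈)
    slot (suc k) {h₁} eq G₁ (node {h} _ slots₂) (inj₂ (inj₂ e)) =
      far-slot br un (merge k) (suc-injective (trans (sym (+-suc h₁ h)) eq)) G₁ (slots₂ Sy) (inj₂ e)
    slot (suc k) {suc h₁} {h₂} eq (node _ slots₁) G₂ (inj₂ (inj₁ w∈)) =
      far-slot (flip br) (flipᵁ un) (merge k) (trans (+-comm h₂ h₁) (suc-injective eq)) G₂ (slots₁ Sx) (inj₁ w∈)
    slot (suc k) {suc h₁} {h₂} eq (node _ slots₁) G₂@(single _ _) (inj₂ (inj₂ e)) =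
      far-slot (flip br) (flipᵁ un) (merge k) (trans (+-comm h₂ h₁) (suc-injective eq)) G₂ (slots₁ Sx)
        (inj₂ ([ inj₂ , inj₁ ]′ e))
    slot (suc k) () (single _ _) (single _ _) (inj₂ (inj₂ _))

  u-other : ∀ {S h} (f : Frame S h) β → Frame.u f (not β) ≢ Frame.u f β
  u-other f true  = Frame.u-dist f ∘ sym
  u-other f false = Frame.u-dist f

  -- A frame with a good colour shows one decomposition, but a gadget needs one for each vertex. The
  -- path `t`, `u (not β)`, `z`, `u β` bridges the core and the single vertex `u β`, so merging
  -- supplies them all.
  refill : ∀ {S h e β} (f : Frame S h) → Good f e β → Gad S (λ i → Frame.Δ f i ⊎ i ≡ e) (suc h)
  refill {S} {h} {e} {β} f (zu , t , Tt , ut) =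
    merge h (+-identityʳ h) core (single {S = _≡ u β} {Γ = λ _ → ⊥} (λ { refl refl → refl }) (λ ())) br un
    where
    open Frame f
    br : Bridge T (_≡ u β) e
    br = record
      { x = t ; b = u (not β) ; a = z ; y = u β ; Sx = Tt ; Sy = refl ; bx = ut ; ay = zu
      ; ab = u-side (not β) ; disj = λ { s refl → u∉T β s } ; a∉₁ = z∉T
      ; a∉₂ = opposite-≢ (u-side β) ; b∉₁ = u∉T (not β) ; b∉₂ = u-other f β }
    sp : ∀ β {v} → T v ⊎ v ≡ z ⊎ ∃ (λ β′ → v ≡ u β′) → T v ⊎ v ≡ u β ⊎ v ≡ z ⊎ v ≡ u (not β)
    sp _     (inj₁ t)                   = inj₁ t
    sp _     (inj₂ (inj₁ e))            = inj₂ (inj₂ (inj₁ e))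
    sp true  (inj₂ (inj₂ (true , e)))   = inj₂ (inj₁ e)
    sp true  (inj₂ (inj₂ (false , e)))  = inj₂ (inj₂ (inj₂ e))
    sp false (inj₂ (inj₂ (true , e)))   = inj₂ (inj₂ (inj₂ e))
    sp false (inj₂ (inj₂ (false , e)))  = inj₂ (inj₁ e)
    un : Union T (_≡ u β) z (u (not β)) Δ (λ _ → ⊥) e S (λ i → Δ i ⊎ i ≡ e)
    un = record
      { into = sp β ∘ split ; from₁ = T⊆S ; from₂ = λ { refl → Su β } ; from-p = Sz ; from-q = Su (not β)
      ; intoΓ = [ inj₁ , inj₂ ∘ inj₂ ]′ }

  -- Configurations of out edges and gadgets.

  inj₁≢inj₂ : ∀ {g : V} {j : Fin n} {l : V ⊎ Fin n} → l ≡ inj₁ g → l ≢ inj₂ j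
  inj₁≢inj₂ refl ()

  -- lab sends a vertex to its gadget, named by a vertex, or to the colour of its out edge.
  record Base : Set where
    field
      lab      : V → V ⊎ Fin n
      a b      : Fin n → V
      out      : Fin n → Bool
      h        : V → ℕ
      lab-out  : ∀ {v j} → lab v ≡ inj₂ j → out j ≡ true × (v ≡ a j ⊎ v ≡ b j)
      lab-a    : ∀ {j} → out j ≡ true → lab (a j) ≡ inj₂ j
      lab-b    : ∀ {j} → out j ≡ true → lab (b j) ≡ inj₂ j
      out-edge : ∀ {j} → out j ≡ true → mate j (a j) ≡ just (b j)

    In : V → V → Set
    In g v = lab v ≡ inj₁ g

    outs : ℕ
    outs = Σ[ allFin n ] (λ j → if out j then 1 else 0)

    field
      -- The summands stand for the missing colour, the gadgets and the out edges; the weight count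
      -- compares `6 * n` with them.
      total : suc (Σ[ vs ] h + outs) ≤ n

  -- The missing colour c and the colours Γ g hosted by the gadget g.
  record Fill (B : Base) : Set₁ where
    open Base B
    field
      c   : Fin n
      Γ   : V → Fin n → Set
      gad : ∀ g → Gad (In g) (Γ g) (h g)
      cov : ∀ i → i ≡ c ⊎ out i ≡ true ⊎ ∃ λ g → Γ g i

  module _ {B : Base} (F : Fill B) where
    open Base B
    open Fill F
    open Host

    module _ {p q g₁ g₂} (pq : mate c p ≡ just q) (In-p : In g₁ p) (In-q : In g₂ q)
             (H : ∀ g → Host (In g) (Γ g) (λ v → v ≡ p ⊎ v ≡ q)) where
      private
        Place : Fin n → Set
        Place i = i ≡ c ⊎ out i ≡ true ⊎ ∃ λ g → Γ g i

        e : ∀ {i} → Place i → V × V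
        e (inj₁ _)                = p , q
        e {i} (inj₂ (inj₁ _))     = a i , b i
        e (inj₂ (inj₂ (g , γ)))   = edge (H g) γ

        e-joined : ∀ {i} (κ : Place i) → mate i (proj₁ (e κ)) ≡ just (proj₂ (e κ))
        e-joined (inj₁ refl)           = pq
        e-joined (inj₂ (inj₁ o))       = out-edge o
        e-joined (inj₂ (inj₂ (g , γ))) = joined (H g) γ

        Region : ∀ {i} → Place i → V → Set
        Region (inj₁ _) v               = v ≡ p ⊎ v ≡ q
        Region {i} (inj₂ (inj₁ _)) v    = lab v ≡ inj₂ i
        Region (inj₂ (inj₂ (g , _))) v  = In g v × ¬ (v ≡ p ⊎ v ≡ q)

        e-region : ∀ {i} (κ : Place i) → Region κ (proj₁ (e κ)) × Region κ (proj₂ (e κ))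
        e-region (inj₁ _)               = inj₁ refl , inj₂ refl
        e-region (inj₂ (inj₁ o))        = lab-a o , lab-b o
        e-region (inj₂ (inj₂ (g , γ)))  =
          (proj₁ (inside (H g) γ) , proj₁ (avoids (H g) γ)) , (proj₂ (inside (H g) γ) , proj₂ (avoids (H g) γ))

        free : ∀ {v} → v ≡ p ⊎ v ≡ q → ∃ λ g → In g v
        free (inj₁ refl) = _ , In-p
        free (inj₂ refl) = _ , In-q

        regions : ∀ {i j} {κ : Place i} {κ′ : Place j} →
                  (∀ {v} → Region κ v → ¬ Region κ′ v) → Disj (e κ) (e κ′)
        regions {κ = κ} {κ′} ne with e-region κ | e-region κ′
        ... | r₁ , r₂ | s₁ , s₂ = (no₁ r₁ s₁ , no₁ r₁ s₂) , (no₁ r₂ s₁ , no₁ r₂ s₂)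
          where
          no₁ : ∀ {u v} → Region κ u → Region κ′ v → u ≢ v
          no₁ r s refl = ne r s

        e-apart : ∀ {i j} (κ : Place i) (κ′ : Place j) → i ≢ j → Disj (e κ) (e κ′)
        e-apart (inj₁ refl) (inj₁ refl) i≢j = ⊥-elim (i≢j refl)
        e-apart κ@(inj₁ _) κ′@(inj₂ (inj₁ _)) _ =
          regions {κ = κ} {κ′} λ r s → inj₁≢inj₂ (proj₂ (free r)) s
        e-apart κ@(inj₂ (inj₁ _)) κ′@(inj₁ _) _ =
          regions {κ = κ} {κ′} λ s r → inj₁≢inj₂ (proj₂ (free r)) s
        e-apart κ@(inj₁ _) κ′@(inj₂ (inj₂ _)) _ = regions {κ = κ} {κ′} λ r s → proj₂ s r
        e-apart κ@(inj₂ (inj₂ _)) κ′@(inj₁ _) _ = regions {κ = κ} {κ′} λ s r → proj₂ s r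
        e-apart κ@(inj₂ (inj₁ _)) κ′@(inj₂ (inj₁ _)) i≢j =
          regions {κ = κ} {κ′} λ r s → i≢j (inj₂-injective (trans (sym r) s))
        e-apart κ@(inj₂ (inj₁ _)) κ′@(inj₂ (inj₂ _)) _ =
          regions {κ = κ} {κ′} λ r s → inj₁≢inj₂ (proj₁ s) r
        e-apart κ@(inj₂ (inj₂ _)) κ′@(inj₂ (inj₁ _)) _ =
          regions {κ = κ} {κ′} λ s r → inj₁≢inj₂ (proj₁ s) r
        e-apart κ@(inj₂ (inj₂ (g , γ))) κ′@(inj₂ (inj₂ (g′ , δ))) i≢j with g ≟ g′
        ... | yes refl = apart (H g) γ δ i≢j
        ... | no g≢g′  = regions {κ = κ} {κ′} λ r s → g≢g′ (inj₁-injective (trans (sym (proj₁ r)) (proj₁ s)))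

      -- The edge `pq` serves `c`, out edges keep their colours, and every gadget hosts its colours
      -- off `p` and `q`. The regions of these edges are disjoint except within one gadget, where
      -- `apart` of its host applies.
      assemble : Rainbow
      assemble = (λ i → e (cov i)) , (λ i → e-joined (cov i)) , λ i j → e-apart (cov i) (cov j)

    -- Each of the two gadgets loses a single vertex to the edge, which `flex` lets it avoid.
    cross-win : ∀ {p q g₁ g₂} → mate c p ≡ just q → In g₁ p → In g₂ q → g₁ ≢ g₂ → Rainbow
    cross-win {p} {q} {g₁} {g₂} pq Ip Iq g₁≢g₂ = assemble pq Ip Iq host
      where
      host : ∀ g → Host (In g) (Γ g) (λ v → v ≡ p ⊎ v ≡ q)
      host g with g ≟ g₁ | g ≟ g₂
      ... | yes refl | _ =
        avoid (λ { s (inj₁ e) → e ; s (inj₂ refl) → ⊥-elim (g₁≢g₂ (inj₁-injective (trans (sym s) Iq))) }) (flex (gad g) Ip)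
      ... | no _ | yes refl =
        avoid (λ { s (inj₂ e) → e ; s (inj₁ refl) → ⊥-elim (g₁≢g₂ (inj₁-injective (trans (sym Ip) s))) }) (flex (gad g) Iq)
      ... | no ne₁ | no ne₂ =
        any-host (gad g) λ { s (inj₁ refl) → ne₁ (inj₁-injective (trans (sym s) Ip))
                           ; s (inj₂ refl) → ne₂ (inj₁-injective (trans (sym s) Iq)) }

    module _ {j x y g₁ g₂} (oj : out j ≡ true) (bx : mate c (b j) ≡ just x) (ay : mate c (a j) ≡ just y)
             (Ix : In g₁ x) (Iy : In g₂ y) (g₁≢g₂ : g₁ ≢ g₂) where
      private
        -- Merging is a relabelling: the vertices of `g₂` and of the out edge `j` are renamed `g₁`,
        -- and no vertex is labelled `g₂` any more.
        ren : V ⊎ Fin n → V ⊎ Fin n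
        ren (inj₁ g) with g ≟ g₂
        ... | yes _ = inj₁ g₁
        ... | no  _ = inj₁ g
        ren (inj₂ i) with i ≟ᶠ j
        ... | yes _ = inj₁ g₁
        ... | no  _ = inj₂ i

        ren-inj₁ : ∀ l {g} → ren l ≡ inj₁ g → (l ≡ inj₁ g × g ≢ g₂) ⊎ (g ≡ g₁ × (l ≡ inj₁ g₂ ⊎ l ≡ inj₂ j))
        ren-inj₁ (inj₁ g) eq with g ≟ g₂
        ren-inj₁ (inj₁ g) refl | yes refl = inj₂ (refl , inj₁ refl)
        ren-inj₁ (inj₁ g) refl | no ne    = inj₁ (refl , ne)
        ren-inj₁ (inj₂ i) eq with i ≟ᶠ j
        ren-inj₁ (inj₂ i) refl | yes refl = inj₂ (refl , inj₂ refl)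
        ren-inj₁ (inj₂ i) ()   | no _

        ren-inj₂ : ∀ l {i} → ren l ≡ inj₂ i → l ≡ inj₂ i × i ≢ j
        ren-inj₂ (inj₁ g) eq with g ≟ g₂
        ren-inj₂ (inj₁ g) () | yes _
        ren-inj₂ (inj₁ g) () | no _
        ren-inj₂ (inj₂ i) eq with i ≟ᶠ j
        ren-inj₂ (inj₂ i) ()   | yes _
        ren-inj₂ (inj₂ i) refl | no ne = refl , ne

        ren-g₂ : ren (inj₁ g₂) ≡ inj₁ g₁
        ren-g₂ with g₂ ≟ g₂
        ... | yes _ = refl
        ... | no ne = ⊥-elim (ne refl)

        ren-j : ren (inj₂ j) ≡ inj₁ g₁
        ren-j with j ≟ᶠ j
        ... | yes _ = refl
        ... | no ne = ⊥-elim (ne refl)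

        ren-other : ∀ {g} → g ≢ g₂ → ren (inj₁ g) ≡ inj₁ g
        ren-other {g} ne with g ≟ g₂
        ... | yes e = ⊥-elim (ne e)
        ... | no _  = refl

        ren-out : ∀ {i} → i ≢ j → ren (inj₂ i) ≡ inj₂ i
        ren-out {i} ne with i ≟ᶠ j
        ... | yes e = ⊥-elim (ne e)
        ... | no _  = refl

        -- The decisions are arguments so that `gad′` can match on them and see the size reduce.
        h″ : ∀ g → Dec (g ≡ g₁) → Dec (g ≡ g₂) → ℕ
        h″ g (yes _) _       = suc (h g₁ + h g₂)
        h″ g (no _)  (yes _) = 0
        h″ g (no _)  (no _)  = h g

        h′ : V → ℕ
        h′ g = h″ g (g ≟ g₁) (g ≟ g₂)

        out′ : Fin n → Bool
        out′ i = if does (i ≟ᶠ j) then false else out i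

        out′-inv : ∀ {i} → out′ i ≡ true → i ≢ j × out i ≡ true
        out′-inv {i} eq with i ≟ᶠ j
        ... | no ne = ne , eq

        out′-intro : ∀ {i} → i ≢ j → out i ≡ true → out′ i ≡ true
        out′-intro {i} ne o = trans (if-no (i ≟ᶠ j) ne) o

        outs′ : ℕ
        outs′ = Σ[ allFin n ] (λ i → if out′ i then 1 else 0)

        at : ∀ {A : Set} → DecidableEquality A → A → ℕ → A → ℕ
        at _≈_ x k y = if does (y ≈ x) then k else 0

        Σ-at : ∀ {A : Set} (_≈_ : DecidableEquality A) {xs x} k → Unique xs → x ∈ xs → Σ[ xs ] (at _≈_ x k) ≡ k
        Σ-at _≈_ {xs} {x} k u x∈ =
          trans (Σ-only (at _≈_ x k) u x∈ (λ {y} → if-no (y ≈ x))) (if-yes (x ≈ x) refl)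

        outs-drop : outs ≡ suc outs′
        outs-drop = begin
          outs                                             ≡⟨ Σ-cong (allFin n) (λ {i} _ → pt i) ⟩
          Σ[ allFin n ] (λ i → at _≟ᶠ_ j 1 i + (if out′ i then 1 else 0))   ≡⟨ Σ-+ (allFin n) _ _ ⟩
          Σ[ allFin n ] (at _≟ᶠ_ j 1) + outs′               ≡⟨ cong (_+ outs′) (Σ-at _≟ᶠ_ 1 (allFin⁺ n) (∈-allFin j)) ⟩
          suc outs′                                        ∎
          where
          open ≡-Reasoning
          pt : ∀ i → (if out i then 1 else 0) ≡ at _≟ᶠ_ j 1 i + (if out′ i then 1 else 0)
          pt i with i ≟ᶠ j
          ... | yes refl rewrite oj = refl
          ... | no _     = refl

        Σh′ : Σ[ vs ] h′ ≡ suc (Σ[ vs ] h)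
        -- Adding `h g₂` on both sides accounts for the emptied name `g₂` without subtraction.
        Σh′ = +-cancelʳ-≡ (h g₂) _ _ (begin
          Σ[ vs ] h′ + h g₂                                ≡⟨ cong (Σ[ vs ] h′ +_) (sym (Σ-at _≟_ (h g₂) vs-unique (vs-all g₂))) ⟩
          Σ[ vs ] h′ + Σ[ vs ] (at _≟_ g₂ (h g₂))           ≡⟨ sym (Σ-+ vs _ _) ⟩
          Σ[ vs ] (λ g → h′ g + at _≟_ g₂ (h g₂) g)         ≡⟨ Σ-cong vs (λ {g} _ → pt g) ⟩
          Σ[ vs ] (λ g → h g + at _≟_ g₁ (suc (h g₂)) g)    ≡⟨ Σ-+ vs _ _ ⟩
          Σ[ vs ] h + Σ[ vs ] (at _≟_ g₁ (suc (h g₂)))      ≡⟨ cong (Σ[ vs ] h +_) (Σ-at _≟_ (suc (h g₂)) vs-unique (vs-all g₁)) ⟩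
          Σ[ vs ] h + suc (h g₂)                           ≡⟨ +-suc _ _ ⟩
          suc (Σ[ vs ] h) + h g₂                           ∎)
          where
          open ≡-Reasoning
          pt : ∀ g → h′ g + at _≟_ g₂ (h g₂) g ≡ h g + at _≟_ g₁ (suc (h g₂)) g
          pt g with g ≟ g₁ | g ≟ g₂
          ... | yes refl | yes refl = ⊥-elim (g₁≢g₂ refl)
          ... | yes refl | no _     = trans (+-identityʳ _) (sym (+-suc (h g) (h g₂)))
          ... | no _     | yes refl = sym (+-identityʳ _)
          ... | no _     | no _     = refl

      extend-base : Base
      extend-base = record
        { lab = λ v → ren (lab v) ; a = a ; b = b ; out = out′ ; h = h′
        ; lab-out  = λ {v} eq → let e , ne = ren-inj₂ (lab v) eq ; o , w = lab-out e in out′-intro ne o , w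
        ; lab-a    = λ o′ → let ne , o = out′-inv o′ in trans (cong ren (lab-a o)) (ren-out ne)
        ; lab-b    = λ o′ → let ne , o = out′-inv o′ in trans (cong ren (lab-b o)) (ren-out ne)
        ; out-edge = λ o′ → out-edge (proj₂ (out′-inv o′))
        ; total    = ≤-trans (≤-reflexive (begin
            suc (Σ[ vs ] h′ + outs′)        ≡⟨ cong (λ k → suc (k + outs′)) Σh′ ⟩
            suc (suc (Σ[ vs ] h) + outs′)   ≡⟨ cong suc (sym (+-suc (Σ[ vs ] h) outs′)) ⟩
            suc (Σ[ vs ] h + suc outs′)     ≡⟨ cong (λ k → suc (Σ[ vs ] h + k)) (sym outs-drop) ⟩
            suc (Σ[ vs ] h + outs)          ∎)) total }
        where open ≡-Reasoning

      extend-outs : suc (Base.outs extend-base) ≡ outs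
      extend-outs = sym outs-drop

      private
        Γ′ : V → Fin n → Set
        Γ′ g i = (g ≡ g₁ × (Γ g₁ i ⊎ Γ g₂ i ⊎ i ≡ c)) ⊎ (g ≢ g₁ × g ≢ g₂ × Γ g i)

        bridge : Bridge (In g₁) (In g₂) c
        bridge = record
          { x = x ; b = b j ; a = a j ; y = y ; Sx = Ix ; Sy = Iy ; bx = bx ; ay = ay
          ; ab = mate-side (out-edge oj)
          ; disj = λ s t → g₁≢g₂ (inj₁-injective (trans (sym s) t))
          ; a∉₁ = λ s → inj₁≢inj₂ s (lab-a oj) ; a∉₂ = λ s → inj₁≢inj₂ s (lab-a oj)
          ; b∉₁ = λ s → inj₁≢inj₂ s (lab-b oj) ; b∉₂ = λ s → inj₁≢inj₂ s (lab-b oj) }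

        union : Union (In g₁) (In g₂) (a j) (b j) (Γ g₁) (Γ g₂) c (Base.In extend-base g₁) (Γ′ g₁)
        union = record
          { into = λ {v} s → into (ren-inj₁ (lab v) s)
          ; from₁ = λ s → trans (cong ren s) (ren-other g₁≢g₂) ; from₂ = λ s → trans (cong ren s) ren-g₂
          ; from-p = trans (cong ren (lab-a oj)) ren-j ; from-q = trans (cong ren (lab-b oj)) ren-j
          ; intoΓ = λ { (inj₁ (_ , γ)) → γ ; (inj₂ (ne , _)) → ⊥-elim (ne refl) } }
          where
          into : ∀ {v} → (lab v ≡ inj₁ g₁ × g₁ ≢ g₂) ⊎ (g₁ ≡ g₁ × (lab v ≡ inj₁ g₂ ⊎ lab v ≡ inj₂ j)) →
                 In g₁ v ⊎ In g₂ v ⊎ v ≡ a j ⊎ v ≡ b j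
          into (inj₁ (s , _))        = inj₁ s
          into (inj₂ (_ , inj₁ s))   = inj₂ (inj₁ s)
          into (inj₂ (_ , inj₂ s))   = inj₂ (inj₂ (proj₂ (lab-out s)))

        gad′ : ∀ g (d₁ : Dec (g ≡ g₁)) (d₂ : Dec (g ≡ g₂)) → Gad (Base.In extend-base g) (Γ′ g) (h″ g d₁ d₂)
        gad′ g (yes refl) _ = merge _ refl (gad g₁) (gad g₂) bridge union
        -- The name `g₂` has become empty, and `single` admits the empty set.
        gad′ g (no ne₁) (yes refl) = single (λ {v} s → ⊥-elim (empty (ren-inj₁ (lab v) s)))
          λ { (inj₁ (e , _)) → ne₁ e ; (inj₂ (_ , ne , _)) → ne refl }
          where
          empty : ∀ {v} → ¬ ((lab v ≡ inj₁ g × g ≢ g) ⊎ (g ≡ g₁ × (lab v ≡ inj₁ g ⊎ lab v ≡ inj₂ j)))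
          empty (inj₁ (_ , ne)) = ne refl
          empty (inj₂ (e , _))  = ne₁ e
        gad′ g (no ne₁) (no ne₂) =
          Gad-map (λ s → trans (cong ren s) (ren-other ne₂)) (λ {v} s → back (ren-inj₁ (lab v) s))
            (λ { (inj₁ (e , _)) → ⊥-elim (ne₁ e) ; (inj₂ (_ , _ , γ)) → γ }) (gad g)
          where
          back : ∀ {v} → (lab v ≡ inj₁ g × g ≢ g₂) ⊎ (g ≡ g₁ × (lab v ≡ inj₁ g₂ ⊎ lab v ≡ inj₂ j)) → In g v
          back (inj₁ (s , _)) = s
          back (inj₂ (e , _)) = ⊥-elim (ne₁ e)

        cov′ : ∀ {i} → i ≡ c ⊎ out i ≡ true ⊎ (∃ λ g → Γ g i) → i ≡ j ⊎ out′ i ≡ true ⊎ ∃ λ g → Γ′ g i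
        cov′ (inj₁ e) = inj₂ (inj₂ (g₁ , inj₁ (refl , inj₂ (inj₂ e))))
        cov′ {i} (inj₂ (inj₁ o)) with i ≟ᶠ j
        ... | yes e = inj₁ e
        ... | no ne = inj₂ (inj₁ o)
        cov′ (inj₂ (inj₂ (g , γ))) with g ≟ g₁ | g ≟ g₂
        ... | yes refl | _        = inj₂ (inj₂ (g₁ , inj₁ (refl , inj₁ γ)))
        ... | no _     | yes refl = inj₂ (inj₂ (g₁ , inj₁ (refl , inj₂ (inj₁ γ))))
        ... | no ne₁   | no ne₂   = inj₂ (inj₂ (g , inj₂ (ne₁ , ne₂ , γ)))

      -- The out edge of `j` is given up, so `j` becomes the missing colour and `c` is hosted by the
      -- merged gadget.
      extend : Fill extend-base
      extend = record
        { c = j ; Γ = Γ′ ; gad = λ g → gad′ g (g ≟ g₁) (g ≟ g₂) ; cov = λ i → cov′ (cov i) }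

  -- Configurations without a joining edge or a merge.

  record Clean (B : Base) (c : Fin n) : Set where
    open Base B
    field
      no-cross  : ∀ {p q g₁ g₂} → mate c p ≡ just q → In g₁ p → In g₂ q → g₁ ≡ g₂
      no-extend : ∀ {j x y g₁ g₂} → out j ≡ true → mate c (b j) ≡ just x → mate c (a j) ≡ just y →
                  In g₁ x → In g₂ y → g₁ ≡ g₂

  -- A violation of `no-cross` gives a rainbow matching by `cross-win`. A violation of `no-extend`
  -- permits a merge, which lowers `outs`, so `IH` applies.
  scan : ∀ {B} → (∀ B′ → Fill B′ → Base.outs B′ < Base.outs B → Rainbow) →
         (F : Fill B) → Rainbow ⊎ Clean B (Fill.c F)
  scan {B} IH F with collect vs (λ {p} _ → cross p) | collect (allFin n) (λ {j} _ → ext j)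
    where
    open Base B
    open Fill F
    cross : ∀ p → Rainbow ⊎ (∀ {q g₁ g₂} → mate c p ≡ just q → In g₁ p → In g₂ q → g₁ ≡ g₂)
    cross p with mate c p in pq
    ... | nothing = inj₂ λ ()
    ... | just q with lab p in Ip | lab q in Iq
    ...   | inj₂ _  | _       = inj₂ λ _ ()
    ...   | inj₁ _  | inj₂ _  = inj₂ λ { refl _ e → ⊥-elim (inj₁≢inj₂ e Iq) }
    ...   | inj₁ g₁ | inj₁ g₂ with g₁ ≟ g₂
    ...     | yes refl = inj₂ λ { refl refl e → inj₁-injective (trans (sym Iq) e) }
    ...     | no ne    = inj₁ (cross-win F pq Ip Iq ne)
    ext : ∀ j → Rainbow ⊎ (∀ {x y g₁ g₂} → out j ≡ true → mate c (b j) ≡ just x → mate c (a j) ≡ just y →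
                           In g₁ x → In g₂ y → g₁ ≡ g₂)
    ext j with out j in oj
    ... | false = inj₂ λ ()
    ... | true with mate c (b j) in bx | mate c (a j) in ay
    ...   | nothing | _       = inj₂ λ _ ()
    ...   | just _  | nothing = inj₂ λ _ _ ()
    ...   | just x  | just y  with lab x in Ix | lab y in Iy
    ...     | inj₂ _  | _       = inj₂ λ { _ refl _ e _ → ⊥-elim (inj₁≢inj₂ e Ix) }
    ...     | inj₁ _  | inj₂ _  = inj₂ λ { _ _ refl _ e → ⊥-elim (inj₁≢inj₂ e Iy) }
    ...     | inj₁ g₁ | inj₁ g₂ with g₁ ≟ g₂
    ...       | yes refl = inj₂ λ { _ refl refl e e′ → trans (inj₁-injective (trans (sym e) Ix)) (inj₁-injective (trans (sym Iy) e′)) }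
    ...       | no ne    = inj₁ (IH _ (extend F oj bx ay Ix Iy ne) (≤-reflexive (extend-outs F oj bx ay Ix Iy ne)))
  ... | inj₁ r | _      = inj₁ r
  ... | inj₂ _ | inj₁ r = inj₁ r
  ... | inj₂ p | inj₂ q = inj₂ record { no-cross = p (vs-all _) ; no-extend = q (∈-allFin _) }

  -- Counting the edges of the missing colour.

  module Labelled (B : Base) where
    open Base B

    In? : ∀ g v → Dec (In g v)
    In? g v = ≡-dec _≟_ _≟ᶠ_ (lab v) (inj₁ g)

    Inside : Fin n → V → V → Set
    Inside c g u = ∃ λ v → mate c u ≡ just v × In g v

    Inside? : ∀ c g u → Dec (Inside c g u)
    Inside? c g u with mate c u
    ... | nothing = no λ ()
    ... | just v  = map′ (λ s → v , refl , s) (λ { (_ , refl , s) → s }) (In? g v)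

    Full : Fin n → V → Set
    Full c g = (∃ λ v → In g v) × (∀ {u} → In g u → Inside c g u)

    Full? : ∀ c g → Dec (Full c g)
    Full? c g =
      map′ (λ p → Any.satisfied p) (λ (v , s) → lose (vs-all v) s) (Any.any? (In? g) vs)
      ×-dec
      map′ (λ p {u} → All.lookup p (vs-all u)) (λ p → All.tabulate (λ _ → p))
        (All.all? (λ u → In? g u →-dec Inside? c g u) vs)

    -- The common side ensures that a partner of one of the two vertices, lying on the other side,
    -- is a third vertex; hence the loss exceeds that of a gadget that is merely not full.
    record Dead (c : Fin n) (g : V) : Set where
      field
        {u₁ u₂}   : V
        In₁       : In g u₁
        In₂       : In g u₂
        distinct  : u₁ ≢ u₂
        same-side : side u₁ ≡ side u₂
        out₁      : ¬ Inside c g u₁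
        out₂      : ¬ Inside c g u₂

    Members : V → Set
    Members g = Σ (List V) λ xs → (∀ {v} → v ∈ xs → In g v) × (∀ {v} → In g v → v ∈ xs) × length xs ≤ 3 * h g + 1

    members : Fill B → ∀ g → Members g
    members F g with Any.any? (In? g) vs
    ... | yes p = let xs , ⊆In , In⊆ , len = vertices (Fill.gad F g) (proj₂ (Any.satisfied p))
                  in xs , ⊆In , In⊆ , ≤-reflexive len
    ... | no ¬p = [] , (λ ()) , (λ s → ⊥-elim (¬p (lose (vs-all _) s))) , z≤n

    module _ {c : Fin n} (clean : Clean B c) (mem : ∀ g → Members g) where
      open Clean clean

      private
        free : V → Bool
        free u = [ const true , const false ]′ (lab u)

        to-free : V → Bool
        to-free u = maybe′ free false (mate c u)

        -- Both ends of such an out edge have their mates in gadgets, and by `no-extend` in the same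
        -- one.
        double : Fin n → Bool
        double j = to-free (a j) ∧ to-free (b j)

        -- The two ends of an edge of F_c share weight 4 so that an out edge gets at most 6; where the out edge
        -- would get 8, each of the two neighbouring gadget vertices takes over 1.
        weight′ : V ⊎ Fin n → V ⊎ Fin n → ℕ
        weight′ (inj₁ _) (inj₁ _) = 2
        weight′ (inj₁ _) (inj₂ j) = if double j then 1 else 0
        weight′ (inj₂ j) (inj₁ _) = if double j then 3 else 4
        weight′ (inj₂ _) (inj₂ _) = 2

        weight : V → ℕ
        weight u = maybe′ (λ v → weight′ (lab u) (lab v)) 0 (mate c u)

        weight′-edge : ∀ k l → weight′ k l + weight′ l k ≡ 4
        weight′-edge (inj₁ _) (inj₁ _) = refl
        weight′-edge (inj₂ _) (inj₂ _) = refl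
        weight′-edge (inj₁ _) (inj₂ j) with double j
        ... | true  = refl
        ... | false = refl
        weight′-edge (inj₂ j) (inj₁ _) with double j
        ... | true  = refl
        ... | false = refl

        weight-edge : ∀ {u v} → mate c u ≡ just v → weight u + weight v ≡ 4
        weight-edge {u} {v} uv rewrite uv | mate-sym uv = weight′-edge (lab u) (lab v)

        to-free-inv : ∀ {u} → to-free u ≡ true → ∃ λ v → mate c u ≡ just v × ∃ λ g → In g v
        to-free-inv {u} eq with mate c u
        ... | just v with lab v in lv
        ...   | inj₁ g = v , refl , g , lv

        ∧-inv : ∀ {p q} → p ∧ q ≡ true → p ≡ true × q ≡ true
        ∧-inv {true} {true} _ = refl , refl

        weight-≤2 : ∀ {g u} → In g u → weight u ≤ 2
        weight-≤2 {u = u} s with mate c u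
        ... | nothing = z≤n
        ... | just v rewrite s with lab v
        ...   | inj₁ _ = ≤-refl
        ...   | inj₂ j with double j
        ...     | true  = s≤s z≤n
        ...     | false = z≤n

        -- By `no-cross` the vertex is unmatched or its mate is on an out edge; its weight is
        -- positive only if that out edge is `double`.
        outside : ∀ {g u} → In g u → ¬ Inside c g u →
                  weight u ≡ 0 ⊎ ∃ λ j → weight u ≡ 1 × double j ≡ true × out j ≡ true × (mate c u ≡ just (a j) ⊎ mate c u ≡ just (b j))
        outside {g} {u} s ¬in with mate c u in uv
        ... | nothing = inj₁ refl
        ... | just v rewrite s with lab v in lv
        ...   | inj₁ g′ = ⊥-elim (¬in (v , refl , trans lv (cong inj₁ (sym (no-cross uv s lv)))))
        ...   | inj₂ j with double j in dj
        ...     | false = inj₁ refl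
        ...     | true  = inj₂ (j , refl , dj , proj₁ (lab-out lv) , [ (λ { refl → inj₁ refl }) , (λ { refl → inj₂ refl }) ]′ (proj₂ (lab-out lv)))

        outside-≤1 : ∀ {g u} → In g u → ¬ Inside c g u → weight u ≤ 1
        outside-≤1 s ¬in with outside s ¬in
        ... | inj₁ e           = ≤-trans (≤-reflexive e) z≤n
        ... | inj₂ (_ , e , _) = ≤-reflexive e

        Partner : V → V → Set
        Partner g u = ∃ λ y → In g y × ¬ Inside c g y × side y ≡ not (side u)

        to-out : ∀ {g y w j} → mate c y ≡ just w → lab w ≡ inj₂ j → ¬ Inside c g y
        to-out yw lw (v , yv , s) with just-injective (trans (sym yw) yv)
        ... | refl = inj₁≢inj₂ s lw

        -- This applies to the gadget vertices of weight 1.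
        partner : ∀ {g u j} → In g u → double j ≡ true → out j ≡ true →
                  mate c u ≡ just (a j) ⊎ mate c u ≡ just (b j) → Partner g u
        partner {g} {u} {j} s dj oj ua with ∧-inv dj
        ... | fa , fb with to-free-inv fa | to-free-inv fb
        -- The mates of both ends lie in one gadget, which is that of `u`. From `u` across the out
        -- edge to the other mate there are three edges, so the sides differ.
        ...   | y , ay , gy , Iy | x , bx , gx , Ix with no-extend oj bx ay Ix Iy
        partner {g} {u} {j} s dj oj (inj₁ ua) | _ | y , ay , gy , Iy | x , bx , gx , Ix | refl
          with just-injective (trans (sym ay) (mate-sym ua))
        ... | refl = x , trans Ix (trans (sym Iy) s) , to-out (mate-sym bx) (lab-b oj)
                   , trans (mate-side bx) (cong not (trans (mate-side (out-edge oj)) (sym (mate-side ay))))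
        partner {g} {u} {j} s dj oj (inj₂ ub) | _ | y , ay , gy , Iy | x , bx , gx , Ix | refl
          with just-injective (trans (sym bx) (mate-sym ub))
        ... | refl = y , trans Iy (trans (sym Ix) s) , to-out (mate-sym ay) (lab-a oj)
                   , trans (mate-side ay) (cong not (trans (mate-side (mate-sym (out-edge oj))) (sym (mate-side bx))))

        deficit : V → ℕ
        deficit u = 2 ∸ weight u

        -- The right side is weight 2 at each of `3 * h g + 1` vertices; the members `us` witness
        -- how much of it is lost.
        bound : ∀ g us → Unique us → (∀ {u} → u ∈ us → In g u) →
                Σ[ proj₁ (mem g) ] weight + Σ[ us ] deficit ≤ 6 * h g + 2
        bound g us uniq us⊆ = begin
          Σ[ xs ] weight + Σ[ us ] deficit       ≤⟨ +-monoʳ-≤ (Σ[ xs ] weight) (Σ-⊆ deficit uniq (In⊆ ∘ us⊆)) ⟩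
          Σ[ xs ] weight + Σ[ xs ] deficit       ≡⟨ sym (Σ-+ xs weight deficit) ⟩
          Σ[ xs ] (λ u → weight u + deficit u)   ≡⟨ Σ-cong xs (λ u∈ → m+[n∸m]≡n (weight-≤2 (⊆In u∈))) ⟩
          Σ[ xs ] (const 2)                      ≡⟨ Σ-const xs 2 ⟩
          2 * length xs                          ≤⟨ *-monoʳ-≤ 2 len ⟩
          2 * (3 * h g + 1)                      ≡⟨ *-distribˡ-+ 2 (3 * h g) 1 ⟩
          2 * (3 * h g) + 2                      ≡⟨ cong (_+ 2) (sym (*-assoc 2 3 (h g))) ⟩
          6 * h g + 2                            ∎
          where
          open ≤-Reasoning
          xs  = proj₁ (mem g)
          ⊆In = proj₁ (proj₂ (mem g))
          In⊆ = λ {v} → proj₁ (proj₂ (proj₂ (mem g))) {v}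
          len = proj₂ (proj₂ (proj₂ (mem g)))

        bound-by : ∀ g {k} us → Unique us → (∀ {u} → u ∈ us → In g u) → k + 2 ≤ Σ[ us ] deficit →
                   Σ[ proj₁ (mem g) ] weight + k ≤ 6 * h g
        bound-by g {k} us uniq us⊆ big = +-cancelʳ-≤ 2 _ _ (begin
          Σ[ proj₁ (mem g) ] weight + k + 2      ≡⟨ +-assoc (Σ[ proj₁ (mem g) ] weight) k 2 ⟩
          Σ[ proj₁ (mem g) ] weight + (k + 2)    ≤⟨ +-monoʳ-≤ (Σ[ proj₁ (mem g) ] weight) big ⟩
          Σ[ proj₁ (mem g) ] weight + Σ[ us ] deficit ≤⟨ bound g us uniq us⊆ ⟩
          6 * h g + 2                            ∎)
          where open ≤-Reasoning

        loose : ∀ {g u} → In g u → ¬ Inside c g u → 1 ≤ deficit u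
        loose s ¬in = ∸-monoʳ-≤ 2 (outside-≤1 s ¬in)

        zero-deficit : ∀ {u} → weight u ≡ 0 → 2 ≤ deficit u
        zero-deficit e = ≤-reflexive (sym (cong (2 ∸_) e))

        -- A vertex not matched inside loses 2 if its weight is 0; otherwise it and its partner lose
        -- at least 1 each. This cancels the 2 in `6 * h g + 2`.
        bound-nonfull : ∀ {g} → ¬ Full c g → Σ[ proj₁ (mem g) ] weight + 0 ≤ 6 * h g
        bound-nonfull {g} ¬full with mem g in eq
        ... | [] , _ = z≤n
        ... | xs@(v ∷ _) , ⊆In , In⊆ , len with All.all? (Inside? c g) xs
        ...   | yes all = ⊥-elim (¬full ((v , ⊆In (here refl)) , λ s → All.lookup all (In⊆ s)))
        ...   | no ¬all = subst (λ m → Σ[ proj₁ m ] weight + 0 ≤ 6 * h g) eq 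
                (let u , u∈ , ¬i = find (¬All⇒Any¬ (Inside? c g) xs ¬all) in go (u , ⊆In u∈ , ¬i))
          where
          go : (∃ λ u → In g u × ¬ Inside c g u) → Σ[ proj₁ (mem g) ] weight + 0 ≤ 6 * h g
          go (u , s , ¬i) with outside s ¬i
          ... | inj₁ e = bound-by g (u ∷ []) ([] ∷ []) (λ { (here refl) → s })
                           (≤-trans (zero-deficit {u} e) (m≤m+n _ 0))
          ... | inj₂ (j , _ , dj , oj , ua) with partner s dj oj ua
          ...   | y , Iy , ¬iy , sd =
            bound-by g (u ∷ y ∷ []) ((opposite-≢ sd ∷ []) ∷ [] ∷ [])
              (λ { (here refl) → s ; (there (here refl)) → Iy })
              (+-mono-≤ (loose s ¬i) (≤-trans (loose Iy ¬iy) (m≤m+n _ 0)))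

        -- A loss of 3 is needed. If both weights are 0, the two vertices suffice; otherwise the
        -- partner of one of weight 1 is on the opposite side and is a third vertex that loses at
        -- least 1.
        bound-dead : ∀ {g} → Dead c g → Σ[ proj₁ (mem g) ] weight + 1 ≤ 6 * h g
        bound-dead {g} dead with outside (Dead.In₁ dead) (Dead.out₁ dead) | outside (Dead.In₂ dead) (Dead.out₂ dead)
        ... | inj₁ e₁ | inj₁ e₂ = bound-by g (u₁ ∷ u₂ ∷ []) ((distinct ∷ []) ∷ [] ∷ [])
            (λ { (here refl) → In₁ ; (there (here refl)) → In₂ })
            (+-mono-≤ (zero-deficit {u₁} e₁) (≤-trans (loose In₂ out₂) (m≤m+n _ 0)))
          where open Dead dead
        ... | inj₂ (j , _ , dj , oj , ua) | _ with partner (Dead.In₁ dead) dj oj ua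
        ...   | y , Iy , ¬iy , sd = bound-by g (u₁ ∷ u₂ ∷ y ∷ [])
            ((distinct ∷ opposite-≢ sd ∷ []) ∷ (opposite-≢ (trans sd (cong not same-side)) ∷ []) ∷ [] ∷ [])
            (λ { (here refl) → In₁ ; (there (here refl)) → In₂ ; (there (there (here refl))) → Iy })
            (+-mono-≤ (loose In₁ out₁) (+-mono-≤ (loose In₂ out₂) (≤-trans (loose Iy ¬iy) (m≤m+n _ 0))))
          where open Dead dead
        bound-dead {g} dead | inj₁ _ | inj₂ (j , _ , dj , oj , ua) with partner (Dead.In₂ dead) dj oj ua
        ...   | y , Iy , ¬iy , sd = bound-by g (u₁ ∷ u₂ ∷ y ∷ [])
            ((distinct ∷ opposite-≢ (trans sd (cong not (sym same-side))) ∷ []) ∷ (opposite-≢ sd ∷ []) ∷ [] ∷ [])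
            (λ { (here refl) → In₁ ; (there (here refl)) → In₂ ; (there (there (here refl))) → Iy })
            (+-mono-≤ (loose In₁ out₁) (+-mono-≤ (loose In₂ out₂) (≤-trans (loose Iy ¬iy) (m≤m+n _ 0))))
          where open Dead dead

        ends : Fin n → List V
        ends j = if out j then a j ∷ b j ∷ [] else []

        weight-out : ∀ {u j} → lab u ≡ inj₂ j → to-free u ≡ false → weight u ≤ 2
        weight-out {u} lu nf with mate c u
        ... | nothing = z≤n
        ... | just v rewrite lu with lab v
        ...   | inj₂ _ = ≤-refl

        weight-out-≤ : ∀ {u j} → lab u ≡ inj₂ j → weight u ≤ (if double j then 3 else 4)
        weight-out-≤ {u} {j} lu with mate c u
        ... | nothing = z≤n
        ... | just v rewrite lu with lab v
        ...   | inj₁ _ = ≤-refl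
        ...   | inj₂ _ with double j
        ...     | true  = s≤s (s≤s z≤n)
        ...     | false = s≤s (s≤s z≤n)

        -- If both ends have mates in gadgets, the bound is 3 + 3. Otherwise one end has weight at
        -- most 2 and the other at most 4.
        weight-ends : ∀ j → Σ[ ends j ] weight ≤ 6 * (if out j then 1 else 0)
        weight-ends j with out j in oj
        ... | false = z≤n
        ... | true = subst (λ k → weight (a j) + k ≤ 6) (sym (+-identityʳ _)) go
          where
          wa = weight-out-≤ (lab-a oj)
          wb = weight-out-≤ (lab-b oj)
          four : ∀ d → (if d then 3 else 4) ≤ 4
          four true  = n≤1+n 3
          four false = ≤-refl
          go : weight (a j) + weight (b j) ≤ 6
          go with to-free (a j) in fa | to-free (b j) in fb
          ... | false | _     = +-mono-≤ (weight-out (lab-a oj) fa) (≤-trans wb (four (double j)))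
          ... | true  | false = +-mono-≤ {y = 4} (≤-trans wa (four (double j))) (weight-out (lab-b oj) fb)
          ... | true  | true  = +-mono-≤ (subst (λ d → weight (a j) ≤ (if d then 3 else 4)) dj wa)
                                         (subst (λ d → weight (b j) ≤ (if d then 3 else 4)) dj wb)
            where dj : double j ≡ true
                  dj rewrite fa | fb = refl

        -- Every edge of `es c` contributes 4, so the bound is twice the hypothesis on the size.
        total-lower : 6 * n + 4 ≤ Σ[ vs ] weight
        total-lower = begin
          6 * n + 4                 ≡⟨ cong (_+ 4) (*-assoc 2 3 n) ⟩
          2 * (3 * n) + 4           ≡⟨ sym (*-distribˡ-+ 2 (3 * n) 2) ⟩
          2 * (3 * n + 2)           ≤⟨ *-monoʳ-≤ 2 (es-size c) ⟩
          2 * (2 * length (es c))   ≡⟨ sym (*-assoc 2 2 (length (es c))) ⟩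
          4 * length (es c)         ≡⟨ sym (Σ-const (es c) 4) ⟩
          Σ[ es c ] (const 4)       ≡⟨ Σ-cong (es c) (λ {e} e∈ → sym (trans (cong (weight (proj₁ e) +_) (+-identityʳ _)) (weight-edge (es-joined e∈)))) ⟩
          Σ[ es c ] (λ e → Σ[ proj₁ e ∷ proj₂ e ∷ [] ] weight)   ≡⟨ sym (Σ-concatMap _ (es c) weight) ⟩
          Σ[ concatMap (λ e → proj₁ e ∷ proj₂ e ∷ []) (es c) ] weight   ≤⟨ Σ-⊆ weight (es-unique c) (λ _ → vs-all _) ⟩
          Σ[ vs ] weight            ∎
          where open ≤-Reasoning

        total-split : Σ[ vs ] weight ≤ Σ[ vs ] (λ g → Σ[ proj₁ (mem g) ] weight) + 6 * outs
        total-split = begin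
          Σ[ vs ] weight                                ≤⟨ Σ-⊆ weight vs-unique (λ {v} _ → covered v) ⟩
          Σ[ gs ++ os ] weight                          ≡⟨ Σ-++ gs os weight ⟩
          Σ[ gs ] weight + Σ[ os ] weight               ≡⟨ cong₂ _+_ (Σ-concatMap (proj₁ ∘ mem) vs weight) (Σ-concatMap ends (allFin n) weight) ⟩
          Σ[ vs ] (λ g → Σ[ proj₁ (mem g) ] weight) + Σ[ allFin n ] (λ j → Σ[ ends j ] weight)
                                                        ≤⟨ +-monoʳ-≤ (Σ[ vs ] (λ g → Σ[ proj₁ (mem g) ] weight)) (Σ-mono (allFin n) (λ {j} _ → weight-ends j)) ⟩
          Σ[ vs ] (λ g → Σ[ proj₁ (mem g) ] weight) + Σ[ allFin n ] (λ j → 6 * (if out j then 1 else 0))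
                                                        ≡⟨ cong (Σ[ vs ] (λ g → Σ[ proj₁ (mem g) ] weight) +_) (Σ-* (allFin n) 6 _) ⟩
          Σ[ vs ] (λ g → Σ[ proj₁ (mem g) ] weight) + 6 * outs ∎
          where
          open ≤-Reasoning
          gs = concatMap (proj₁ ∘ mem) vs
          os = concatMap ends (allFin n)
          covered : ∀ v → v ∈ gs ++ os
          covered v with lab v in lv
          ... | inj₁ g = ∈-++⁺ˡ (∈-concatMap⁺ (proj₁ ∘ mem) (lose (vs-all g) (proj₁ (proj₂ (proj₂ (mem g))) lv)))
          ... | inj₂ j = ∈-++⁺ʳ gs (∈-concatMap⁺ ends (lose (∈-allFin j) (in-ends (lab-out lv))))
            where
            in-ends : out j ≡ true × (v ≡ a j ⊎ v ≡ b j) → v ∈ ends j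
            in-ends (o , _) rewrite o with proj₂ (lab-out lv)
            ... | inj₁ e = here e
            ... | inj₂ e = there (here e)

      -- A gadget has weight at most `6 * h g`, with 2 more if full and 1 less if dead; an out edge
      -- has at most 6. The total is at least `6 * n + 4` and `suc (H + outs) ≤ n`, so full gadgets
      -- must make up for 6 + 4 and for the loss in `Z`.
      full-count : ∀ {Z} → Unique Z → (∀ {g} → g ∈ Z → Dead c g) →
                   10 + length Z ≤ 2 * length (filter (Full? c) vs)
      full-count {Z} uniq dead = +-cancelʳ-≤ (6 * (H + outs)) _ _ (begin
        10 + length Z + 6 * (H + outs)              ≡⟨ solve 2 (λ z k → con 10 :+ z :+ con 6 :* k := con 6 :* (con 1 :+ k) :+ con 4 :+ z) refl (length Z) (H + outs) ⟩
        6 * suc (H + outs) + 4 + length Z           ≤⟨ +-monoˡ-≤ (length Z) (+-monoˡ-≤ 4 (*-monoʳ-≤ 6 total)) ⟩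
        6 * n + 4 + length Z                        ≤⟨ +-mono-≤ (≤-trans total-lower total-split) Z≤ ⟩
        W + 6 * outs + D                            ≡⟨ solve 3 (λ w o d → w :+ o :+ d := w :+ d :+ o) refl W (6 * outs) D ⟩
        W + D + 6 * outs                            ≤⟨ +-monoˡ-≤ (6 * outs) W+D ⟩
        6 * H + 2 * f + 6 * outs                    ≡⟨ solve 3 (λ h f o → con 6 :* h :+ con 2 :* f :+ con 6 :* o := con 2 :* f :+ con 6 :* (h :+ o)) refl H f outs ⟩
        2 * f + 6 * (H + outs)                      ∎)
        where
        open ≤-Reasoning
        open +-*-Solver
        H = Σ[ vs ] h
        f = length (filter (Full? c) vs)
        W = Σ[ vs ] (λ g → Σ[ proj₁ (mem g) ] weight)
        D = Σ[ vs ] (λ g → [ g ∈? Z ]ᵇ)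
        ind : ∀ {g} → g ∈ Z → 1 ≤ [ g ∈? Z ]ᵇ
        ind {g} g∈ with g ∈? Z
        ... | yes _ = ≤-refl
        ... | no ¬p = ⊥-elim (¬p g∈)
        Z≤ : length Z ≤ D
        Z≤ = begin
          length Z                   ≡⟨ sym (trans (Σ-const Z 1) (*-identityˡ _)) ⟩
          Σ[ Z ] (const 1)           ≤⟨ Σ-mono Z ind ⟩
          Σ[ Z ] (λ g → [ g ∈? Z ]ᵇ)  ≤⟨ Σ-⊆ _ uniq (λ _ → vs-all _) ⟩
          D                          ∎
        at-most : ∀ g (dz : Dec (g ∈ Z)) (df : Dec (Full c g)) →
                  Σ[ proj₁ (mem g) ] weight + [ dz ]ᵇ ≤ 6 * h g + 2 * [ df ]ᵇ
        at-most g (yes g∈) (yes full) = ⊥-elim (Dead.out₁ (dead g∈) (proj₂ full (Dead.In₁ (dead g∈))))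
        at-most g (yes g∈) (no _)     = ≤-trans (bound-dead (dead g∈)) (m≤m+n _ 0)
        at-most g (no _)   (yes _)    = bound g [] [] (λ ())
        at-most g (no _)   (no ¬full) = ≤-trans (bound-nonfull ¬full) (m≤m+n _ 0)
        W+D : W + D ≤ 6 * H + 2 * f
        W+D = begin
          W + D                                                       ≡⟨ sym (Σ-+ vs _ _) ⟩
          Σ[ vs ] (λ g → Σ[ proj₁ (mem g) ] weight + [ g ∈? Z ]ᵇ)      ≤⟨ Σ-mono vs (λ {g} _ → at-most g (g ∈? Z) (Full? c g)) ⟩
          Σ[ vs ] (λ g → 6 * h g + 2 * [ Full? c g ]ᵇ)                 ≡⟨ Σ-+ vs _ _ ⟩
          Σ[ vs ] (λ g → 6 * h g) + Σ[ vs ] (λ g → 2 * [ Full? c g ]ᵇ) ≡⟨ cong₂ _+_ (Σ-* vs 6 h) (trans (Σ-* vs 2 _) (cong (2 *_) (Σ-filter (Full? c) vs))) ⟩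
          6 * H + 2 * f                                               ∎


  -- Room inside a gadget.

  module _ {S h} (f : Frame S h) where
    open Frame f

    u-u-side : ∀ β β′ → side (u β) ≡ side (u β′)
    u-u-side β β′ = trans (u-side β) (sym (u-side β′))

    -- Of the two edges of `e` in the frame, the one from `u (not β)` to the core is used.
    host-off-zu : ∀ {e β} → Good f e β → Host S (λ i → Δ i ⊎ i ≡ e) (λ v → v ≡ z ⊎ v ≡ u β)
    host-off-zu {e} {β} (_ , t , Tt , ut) =
      add-edge (flex core Tt) T⊆S ut (Su (not β)) (T⊆S Tt)
        [ opposite-≢ (u-side (not β)) ∘ sym , u-other f β ]′
        [ (λ { refl → z∉T Tt }) , (λ { refl → u∉T β Tt }) ]′
        (λ { t′ (inj₁ refl) → ⊥-elim (u∉T (not β) t′) ; _ (inj₂ (inj₁ e)) → e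
           ; t′ (inj₂ (inj₂ (inj₁ refl))) → ⊥-elim (z∉T t′) ; t′ (inj₂ (inj₂ (inj₂ refl))) → ⊥-elim (u∉T β t′) })
        id

    -- Here `e` uses the edge from `z` to `u β`, so `t` may be any core vertex.
    host-off-ut : ∀ {e β t} → Good f e β → T t → Host S (λ i → Δ i ⊎ i ≡ e) (λ v → v ≡ u (not β) ⊎ v ≡ t)
    host-off-ut {e} {β} (zu , _) Tt =
      add-edge (flex core Tt) T⊆S zu Sz (Su β)
        [ opposite-≢ (u-side (not β)) , (λ { refl → z∉T Tt }) ]′
        [ u-other f β ∘ sym , (λ { refl → u∉T β Tt }) ]′
        (λ { t′ (inj₁ refl) → ⊥-elim (z∉T t′) ; t′ (inj₂ (inj₁ refl)) → ⊥-elim (u∉T β t′)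
           ; t′ (inj₂ (inj₂ (inj₁ refl))) → ⊥-elim (u∉T (not β) t′) ; t′ (inj₂ (inj₂ (inj₂ e))) → e })
        id

  -- States with a fixed choice of decompositions.

  module Search {B : Base} (F₀ : Fill B) (IH : ∀ B′ → Fill B′ → Base.outs B′ < Base.outs B → Rainbow) where
    open Base B
    open Labelled B
    open Fill F₀ using () renaming (c to c₀; Γ to Γ₀; gad to gad₀; cov to cov₀)

    record Slotted (g : V) : Set₁ where
      field
        {h⁻}    : ℕ
        h≡      : h g ≡ suc h⁻
        frame   : Frame (In g) h⁻
        d       : Fin n
        β       : Bool
        good    : Good frame d β
        colours : ∀ {i} → Γ₀ g i → Frame.Δ frame i ⊎ i ≡ d

    record Flat (g : V) : Set where
      field
        h≡   : h g ≡ 0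
        only : ∀ {u v} → In g u → In g v → u ≡ v
        ¬Γ   : ∀ {i} → ¬ Γ₀ g i

    -- From here on the gadgets and their decompositions are fixed; a state says which colour is missing and
    -- which colour each decomposed gadget hosts outside its core.
    Kind : V → Set₁
    Kind g = Flat g ⊎ Slotted g

    kind : ∀ g → Kind g
    kind g = go (gad₀ g) refl
      where
      go : ∀ {k} → Gad (In g) (Γ₀ g) k → h g ≡ k → Kind g
      go (single only ¬Γ) eq = inj₁ record { h≡ = eq ; only = only ; ¬Γ = ¬Γ }
      go (node s slots)   eq = inj₂ record
        { h≡ = eq ; frame = Slot.frame sl ; d = Slot.d sl ; β = Slot.β sl ; good = Slot.good sl ; colours = Slot.colours sl }
        where sl = slots s

    module _ {g : V} where
      IsSlot : Kind g → Set
      IsSlot (inj₁ _) = ⊥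
      IsSlot (inj₂ _) = ⊤

      Col : Kind g → Fin n → Fin n → Set
      Col (inj₁ _) e i = ⊥
      Col (inj₂ s) e i = Frame.Δ (Slotted.frame s) i ⊎ i ≡ e

      Fits : Kind g → Fin n → Bool → Set
      Fits (inj₁ _) e β = ⊥
      Fits (inj₂ s) e β = Good (Slotted.frame s) e β

      Fits-slot : ∀ k {e β} → Fits k e β → IsSlot k
      Fits-slot (inj₂ _) _ = tt

      Col-self : ∀ k {e} → IsSlot k → Col k e e
      Col-self (inj₂ _) _ = inj₂ refl

      Col-inv : ∀ k {e i} → Col k e i → (∀ e′ → Col k e′ i) ⊎ (IsSlot k × i ≡ e)
      Col-inv (inj₂ s) (inj₁ δ) = inj₁ λ _ → inj₁ δ
      Col-inv (inj₂ s) (inj₂ e) = inj₂ (tt , e)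

      gadget : ∀ k {e} → (IsSlot k → ∃ (Fits k e)) → Gad (In g) (Col k e) (h g)
      gadget (inj₁ flat) _ = subst (Gad (In g) _) (sym (Flat.h≡ flat)) (single (Flat.only flat) id)
      gadget (inj₂ s) fits =
        subst (Gad (In g) _) (sym (Slotted.h≡ s)) (refill (Slotted.frame s) (proj₂ (fits tt)))

    IsSlotAt : V → Set
    IsSlotAt g = IsSlot (kind g)

    FitsAt : V → Fin n → Bool → Set
    FitsAt g = Fits (kind g)

    Cov : Fin n → (V → Fin n) → Set
    Cov c occ = ∀ i → i ≡ c ⊎ out i ≡ true ⊎ ∃ λ g → Col (kind g) (occ g) i

    record State (c : Fin n) (occ : V → Fin n) : Set where
      field
        fits : ∀ g → IsSlotAt g → ∃ (FitsAt g (occ g))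
        cov  : Cov c occ

    fill : ∀ {c occ} → State c occ → Fill B
    fill {c} {occ} σ = record
      { c = c ; Γ = λ g → Col (kind g) (occ g) ; gad = λ g → gadget (kind g) (State.fits σ g) ; cov = State.cov σ }

    -- Stated for a kind and two colours, so that the next lemmas can match on the kind without
    -- unfolding a state.
    Win : ∀ {g} → Kind g → Fin n → Fin n → Set
    Win {g} k c e = ∀ {p q} → mate c p ≡ just q → In g p → In g q → Host (In g) (Col k e) (λ v → v ≡ p ⊎ v ≡ q) → Rainbow

    local-win : ∀ {c occ} → State c occ → ∀ g → Win (kind g) c (occ g)
    local-win {c} {occ} σ g {p} {q} pq Ip Iq H = assemble F pq Ip Iq host
      where
      F = fill σ
      host : ∀ g′ → Host (In g′) (Fill.Γ F g′) (λ v → v ≡ p ⊎ v ≡ q)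
      host g′ with g′ ≟ g
      ... | yes refl = H
      ... | no ne    = any-host (Fill.gad F g′) λ { s (inj₁ refl) → ne (inj₁-injective (trans (sym s) Ip))
                                                 ; s (inj₂ refl) → ne (inj₁-injective (trans (sym s) Iq)) }

    full-slot : ∀ {c g} → Full c g → IsSlotAt g
    full-slot {c} {g} ((v , Iv) , inside) = go (kind g)
      where
      go : ∀ k → IsSlot {g} k
      go (inj₂ _)    = tt
      go (inj₁ flat) = let w , vw , Iw = inside Iv in ⊥-elim (opposite-≢ (mate-side vw) (Flat.only flat Iv Iw))

    -- The mate of `u (not β)` is inside. If it is in the core, `host-off-ut` leaves room for that
    -- edge; it is no `u`-vertex by sides; so it is `z`. Then `u β` can only have its mate in the
    -- core.
    full-fits : ∀ {c e g β} (k : Kind g) → Win k c e → Full c g → Fits k e β → Rainbow ⊎ Fits k c (not β)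
    full-fits {c} {g = g} {β} (inj₂ s) win (_ , inside) good = first (inside (Su (not β)))
      where
      open Slotted s using (frame)
      open Frame frame
      second : mate c (u (not β)) ≡ just z → Inside c g (u β) → Good frame c (not β)
      second uz (v , uv , Iv) with split Iv
      ... | inj₁ Tv = mate-sym uz , v , Tv , subst (λ γ → mate c (u γ) ≡ just v) (sym (not-involutive β)) uv
      ... | inj₂ (inj₁ refl) = ⊥-elim (u-other frame β (just-injective (trans (sym (mate-sym uz)) (mate-sym uv))))
      ... | inj₂ (inj₂ (β′ , refl)) = ⊥-elim (not-¬ (u-u-side frame β′ β) (mate-side uv))
      first : Inside c g (u (not β)) → Rainbow ⊎ Good frame c (not β)
      first (v , uv , Iv) with split Iv
      ... | inj₁ Tv = inj₁ (win uv (Su (not β)) Iv (host-off-ut frame good Tv))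
      ... | inj₂ (inj₁ refl) = inj₂ (second uv (inside (Su β)))
      ... | inj₂ (inj₂ (β′ , refl)) = ⊥-elim (not-¬ (u-u-side frame β′ (not β)) (mate-side uv))

    -- An edge of `c` inside the gadget at a `u`-vertex leads to `z` or to the core. An occupant of
    -- one type leaves room for the former, of the other type for the latter. So without a rainbow
    -- matching both `u`-vertices are loose.
    both-fit : ∀ {c g} (k : Kind g) → IsSlot k → (∀ β → ∃ λ e → Fits k e β × Win k c e) → Rainbow ⊎ Dead c g
    both-fit {c} {g} (inj₂ s) _ each with free true false refl | free false true refl
      where
      open Slotted s using (frame)
      open Frame frame
      free : ∀ β γ → not γ ≡ β → Rainbow ⊎ ¬ Inside c g (u β)
      free _ γ refl with Inside? c g (u (not γ))
      ... | no ¬in = inj₂ ¬in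
      ... | yes (v , uv , Iv) with split Iv
      ...   | inj₁ Tv = let e , good , win = each γ in inj₁ (win uv (Su (not γ)) Iv (host-off-ut frame good Tv))
      ...   | inj₂ (inj₁ refl) = let e , good , win = each (not γ) in
                                 inj₁ (win (mate-sym uv) Sz (Su (not γ)) (host-off-zu frame good))
      ...   | inj₂ (inj₂ (β′ , refl)) = ⊥-elim (not-¬ (u-u-side frame β′ (not γ)) (mate-side uv))
    ... | inj₁ r | _ = inj₁ r
    ... | inj₂ _ | inj₁ r = inj₁ r
    ... | inj₂ o₁ | inj₂ o₂ = inj₂ record
      { In₁ = Su true ; In₂ = Su false ; distinct = u-dist ; same-side = u-u-side (Slotted.frame s) true false
      ; out₁ = o₁ ; out₂ = o₂ }
      where open Frame (Slotted.frame s)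

    occ₀ : V → Fin n
    occ₀ g = [ const c₀ , Slotted.d ]′ (kind g)

    fits₀ : ∀ g → IsSlotAt g → ∃ (FitsAt g (occ₀ g))
    fits₀ g with kind g
    ... | inj₁ _ = λ ()
    ... | inj₂ s = λ _ → Slotted.β s , Slotted.good s

    cov-initial : Cov c₀ occ₀
    cov-initial i with cov₀ i
    ... | inj₁ e                = inj₁ e
    ... | inj₂ (inj₁ o)         = inj₂ (inj₁ o)
    ... | inj₂ (inj₂ (g , γ))   = inj₂ (inj₂ (g , go))
      where
      go : Col (kind g) (occ₀ g) i
      go with kind g
      ... | inj₁ flat = Flat.¬Γ flat γ
      ... | inj₂ s    = Slotted.colours s γ

    -- Core colours and colours of out edges stay in place, so only the missing colour and the
    -- occupants need a new place.
    cov-move : ∀ {c c′ occ occ′} → Cov c occ →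
               c ≡ c′ ⊎ (∃ λ g → IsSlotAt g × occ′ g ≡ c) →
               (∀ {g} → IsSlotAt g → occ g ≡ c′ ⊎ ∃ λ g′ → IsSlotAt g′ × occ′ g′ ≡ occ g) → Cov c′ occ′
    cov-move {c} {c′} {occ} {occ′} cov at-c at-g i with cov i
    ... | inj₂ (inj₁ o) = inj₂ (inj₁ o)
    ... | inj₁ refl = place at-c
      where
      place : c ≡ c′ ⊎ (∃ λ g → IsSlotAt g × occ′ g ≡ c) → c ≡ c′ ⊎ out c ≡ true ⊎ ∃ λ g → Col (kind g) (occ′ g) c
      place (inj₁ e)           = inj₁ e
      place (inj₂ (g , s , e)) = inj₂ (inj₂ (g , subst (λ d → Col (kind g) d c) (sym e) (Col-self (kind g) s)))
    ... | inj₂ (inj₂ (g , γ)) with Col-inv (kind g) γ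
    ...   | inj₁ fixed = inj₂ (inj₂ (g , fixed (occ′ g)))
    ...   | inj₂ (s , refl) with at-g s
    ...     | inj₁ e = inj₁ e
    ...     | inj₂ (g′ , s′ , e) = inj₂ (inj₂ (g′ , subst (λ d → Col (kind g′) d i) (sym e) (Col-self (kind g′) s′)))

    upd : (V → Fin n) → V → Fin n → V → Fin n
    upd o s c g = if does (g ≟ s) then c else o g

    upd-at : ∀ o s c → upd o s c s ≡ c
    upd-at o s c = if-yes (s ≟ s) refl

    upd-off : ∀ o {s} c {g} → g ≢ s → upd o s c g ≡ o g
    upd-off o {s} c {g} = if-no (g ≟ s)

    -- Exchange paths.

    -- The state after exchanging along a path, whose latest gadget comes first.
    mutual
      miss : List V → Fin n
      miss []       = c₀
      miss (s ∷ ps) = occ ps s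

      occ : List V → V → Fin n
      occ []       = occ₀
      occ (s ∷ ps) = upd (occ ps) s (miss ps)

    -- As `s` is new to the path, its occupant is still the original one. The two types recorded for
    -- `s` are opposite; this is what later makes it dead.
    data Path : List V → Set where
      []  : Path []
      cons : ∀ {s ps} β → s ∉ ps → FitsAt s (occ₀ s) β → FitsAt s (miss ps) (not β) → Path ps → Path (s ∷ ps)

    off-path : ∀ P {g} → g ∉ P → occ P g ≡ occ₀ g
    off-path []       _  = refl
    off-path (s ∷ ps) g∉ = trans (upd-off (occ ps) (miss ps) (g∉ ∘ here)) (off-path ps (g∉ ∘ there))

    on-path : ∀ {P g} → Path P → g ∈ P → ∃ λ β → FitsAt g (occ₀ g) β × FitsAt g (occ P g) (not β)
    on-path {s ∷ ps} (cons β _ f₀ f _) (here refl) =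
      β , f₀ , subst (λ e → FitsAt s e (not β)) (sym (upd-at (occ ps) s (miss ps))) f
    on-path {s ∷ ps} {g} (cons _ s∉ _ _ path) (there g∈) with on-path path g∈
    ... | β , f₀ , f = β , f₀ , subst (λ e → FitsAt g e (not β)) (sym (upd-off (occ ps) (miss ps) λ { refl → s∉ g∈ })) f

    path-slot : ∀ {P g} → Path P → g ∈ P → IsSlotAt g
    path-slot {g = g} path g∈ = Fits-slot (kind g) (proj₁ (proj₂ (on-path path g∈)))

    path-fits : ∀ {P} → Path P → ∀ g → IsSlotAt g → ∃ (FitsAt g (occ P g))
    path-fits {P} path g s with g ∈? P
    ... | yes g∈ = let β , _ , f = on-path path g∈ in not β , f
    ... | no g∉  = subst (λ e → ∃ (FitsAt g e)) (sym (off-path P g∉)) (fits₀ g s)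

    path-cov : ∀ {P} → Path P → Cov (miss P) (occ P)
    path-cov [] = cov-initial
    path-cov {s ∷ ps} path@(cons _ _ _ _ p) = cov-move (path-cov p)
      (inj₂ (s , path-slot path (here refl) , upd-at (occ ps) s (miss ps))) go
      where
      go : ∀ {g} → IsSlotAt g → occ ps g ≡ occ ps s ⊎ ∃ λ g′ → IsSlotAt g′ × occ (s ∷ ps) g′ ≡ occ ps g
      go {g} sg with g ≟ s
      ... | yes refl = inj₁ refl
      ... | no ne    = inj₂ (g , sg , upd-off (occ ps) (miss ps) ne)

    path-state : ∀ {P} → Path P → State (miss P) (occ P)
    path-state path = record { fits = path-fits path ; cov = path-cov path }

    suffix : ∀ xs {ys} → Path (xs ++ ys) → Path ys
    suffix []       path             = path
    suffix (x ∷ xs) (cons _ _ _ _ p) = suffix xs p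

    -- Rearrangements and dead gadgets.

    -- A rearrangement of the colours within Fn that changes the type at z.
    record Alt (Fn : List V) (z : V) : Set where
      field
        alt     : V → Fin n
        support : ∀ {g} → g ∉ Fn → alt g ≡ occ₀ g
        fits    : ∀ g → IsSlotAt g → ∃ (FitsAt g (alt g))
        cover   : ∀ {g} → g ∈ Fn → ∃ λ g′ → g′ ∈ Fn × alt g′ ≡ occ₀ g
        β       : Bool
        fits₁   : FitsAt z (occ₀ z) β
        fits₂   : FitsAt z (alt z) (not β)

    widen : ∀ {Fn Fn′ z} → (∀ {g} → g ∈ Fn → g ∈ Fn′) → Alt Fn z → Alt Fn′ z
    widen {Fn} {Fn′} sub A = record
      { alt = alt ; support = λ g∉ → support (g∉ ∘ sub) ; fits = fits ; cover = go ; β = β ; fits₁ = fits₁ ; fits₂ = fits₂ }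
      where
      open Alt A
      go : ∀ {g} → g ∈ Fn′ → ∃ λ g′ → g′ ∈ Fn′ × alt g′ ≡ occ₀ g
      go {g} g∈ with g ∈? Fn
      ... | yes g∈Fn = let g′ , g′∈ , e = cover g∈Fn in g′ , sub g′∈ , e
      ... | no g∉Fn  = g , g∈ , support g∉Fn

    module _ {P Fn z} (path : Path P) (disj : ∀ {g} → g ∈ P → g ∉ Fn) (slots : ∀ {g} → g ∈ Fn → IsSlotAt g)
             (A : Alt Fn z) where
      open Alt A

      private
        mix : V → Fin n
        mix g = if does (g ∈? Fn) then alt g else occ P g

        mix-in : ∀ {g} → g ∈ Fn → mix g ≡ alt g
        mix-in {g} = if-yes (g ∈? Fn)

        mix-out : ∀ {g} → g ∉ Fn → mix g ≡ occ P g
        mix-out {g} = if-no (g ∈? Fn)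

        mix-fits : ∀ g → IsSlotAt g → ∃ (FitsAt g (mix g))
        mix-fits g s with g ∈? Fn
        ... | yes _ = fits g s
        ... | no _  = path-fits path g s

        mix-cov : Cov (miss P) mix
        mix-cov = cov-move (path-cov path) (inj₁ refl) go
          where
          go : ∀ {g} → IsSlotAt g → occ P g ≡ miss P ⊎ ∃ λ g′ → IsSlotAt g′ × mix g′ ≡ occ P g
          go {g} s with g ∈? Fn
          ... | yes g∈ = let g′ , g′∈ , e = cover g∈ in
            inj₂ (g′ , slots g′∈ , trans (mix-in g′∈) (trans e (sym (off-path P (λ g∈P → disj g∈P g∈)))))
          ... | no g∉  = inj₂ (g , s , mix-out g∉)

        mix-state : State (miss P) mix
        mix-state = record { fits = mix-fits ; cov = mix-cov }

      -- `mix` follows `alt` on `Fn` and the path elsewhere. As these are disjoint, the missing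
      -- colour is the same, while the occupants of `z` in the two states have opposite types, so
      -- `both-fit` applies.
      alt-dead : z ∈ Fn → Rainbow ⊎ Dead (miss P) z
      alt-dead z∈ = both-fit (kind z) (slots z∈) (each β fits₁ fits₂)
        where
        here′ : ∀ {β} → FitsAt z (occ₀ z) β → ∃ λ e → FitsAt z e β × Win (kind z) (miss P) e
        here′ {β} f = occ P z , subst (λ e → FitsAt z e β) (sym (off-path P λ z∈P → disj z∈P z∈)) f
                    , local-win (path-state path) z
        there′ : ∀ {β} → FitsAt z (alt z) β → ∃ λ e → FitsAt z e β × Win (kind z) (miss P) e
        there′ {β} f = mix z , subst (λ e → FitsAt z e β) (sym (mix-in z∈)) f , local-win mix-state z
        each : ∀ β → FitsAt z (occ₀ z) β → FitsAt z (alt z) (not β) →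
               ∀ γ → ∃ λ e → FitsAt z e γ × Win (kind z) (miss P) e
        each true  f f′ true  = here′ f
        each true  f f′ false = there′ f′
        each false f f′ true  = there′ f′
        each false f f′ false = here′ f

    module _ {s : V} {ys : List V} where
      -- The missing colour enters s, which closes the segment of the path since s into a cycle.
      turned : List V → V → Fin n
      turned xs g = if does (g ≟ s) then miss (xs ++ s ∷ ys) else occ (xs ++ s ∷ ys) g

      turned-s : ∀ xs → turned xs s ≡ miss (xs ++ s ∷ ys)
      turned-s xs = if-yes (s ≟ s) refl

      turned-off : ∀ xs {g} → g ≢ s → turned xs g ≡ occ (xs ++ s ∷ ys) g
      turned-off xs {g} = if-no (g ≟ s)

      -- The original occupants are permuted cyclically. An added gadget `x` takes the colour that
      -- would have entered `s`, and the original occupant of `x` becomes the missing colour, which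
      -- now enters `s`.
      turned-cover : ∀ xs → Path (xs ++ s ∷ ys) → ∀ {g} → g ∈ s ∷ xs →
                     ∃ λ g′ → g′ ∈ s ∷ xs × turned xs g′ ≡ occ₀ g
      turned-cover [] (cons _ s∉ _ _ _) (here refl) = s , here refl , trans (turned-s []) (off-path ys s∉)
      turned-cover (x ∷ xs) (cons _ x∉ _ _ path) g∈ = go g∈
        where
        P = xs ++ s ∷ ys
        x≢s : x ≢ s
        x≢s refl = x∉ (∈-++⁺ʳ xs (here refl))
        old : ∀ {g} → g ∈ s ∷ xs → ∃ λ g′ → g′ ∈ s ∷ x ∷ xs × turned (x ∷ xs) g′ ≡ occ₀ g
        old g∈ with turned-cover xs path g∈
        ... | _ , here refl , e =
          x , there (here refl)
            , trans (turned-off (x ∷ xs) x≢s) (trans (upd-at (occ P) x (miss P)) (trans (sym (turned-s xs)) e))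
        ... | g′ , there g′∈ , e with g′ ≟ s
        ...   | yes refl =
          x , there (here refl)
            , trans (turned-off (x ∷ xs) x≢s) (trans (upd-at (occ P) x (miss P)) e)
        ...   | no ne =
          g′ , there (there g′∈)
             , trans (turned-off (x ∷ xs) ne) (trans (upd-off (occ P) (miss P) (λ { refl → x∉ (∈-++⁺ˡ g′∈) })) e)
        go : ∀ {g} → g ∈ s ∷ x ∷ xs → ∃ λ g′ → g′ ∈ s ∷ x ∷ xs × turned (x ∷ xs) g′ ≡ occ₀ g
        go (here refl)         = old (here refl)
        go (there (here refl)) = s , here refl , trans (turned-s (x ∷ xs)) (off-path P x∉)
        go (there (there g∈))  = old (there g∈)

      module _ {xs : List V} (path : Path (xs ++ s ∷ ys)) (s∉xs : s ∉ xs)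
               (f : ∃ (FitsAt s (miss (xs ++ s ∷ ys)))) where
        private
          turn : V → Fin n
          turn g = if does (g ∈? s ∷ xs) then turned xs g else occ₀ g

          turn-in : ∀ {g} → g ∈ s ∷ xs → turn g ≡ turned xs g
          turn-in {g} = if-yes (g ∈? s ∷ xs)

          turn-out : ∀ {g} → g ∉ s ∷ xs → turn g ≡ occ₀ g
          turn-out {g} = if-no (g ∈? s ∷ xs)

          turn-xs : ∀ {g} → g ∈ xs → turn g ≡ occ (xs ++ s ∷ ys) g
          turn-xs g∈ = trans (turn-in (there g∈)) (turned-off xs λ { refl → s∉xs g∈ })

          turn-fits : ∀ g → IsSlotAt g → Dec (g ∈ s ∷ xs) → ∃ (FitsAt g (turn g))
          turn-fits g sg (yes (here refl)) = subst (λ e → ∃ (FitsAt g e)) (sym (trans (turn-in (here refl)) (turned-s xs))) f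
          turn-fits g sg (yes (there g∈)) = subst (λ e → ∃ (FitsAt g e)) (sym (turn-xs g∈)) (path-fits path g sg)
          turn-fits g sg (no g∉) = subst (λ e → ∃ (FitsAt g e)) (sym (turn-out g∉)) (fits₀ g sg)

        -- Gadgets in `xs` keep their path colours, whose types are opposite to the original ones.
        -- In the search, `s` regains its original type, so it is closed and not dead.
        turn-alt : ∀ {z} → z ∈ xs → Alt (s ∷ xs) z
        turn-alt {z} z∈ with on-path path (∈-++⁺ˡ z∈)
        ... | β , f₀ , f₁ = record
          { alt = turn ; support = turn-out ; fits = λ g sg → turn-fits g sg (g ∈? s ∷ xs)
          ; cover = λ g∈ → let g′ , g′∈ , e = turned-cover xs path g∈ in g′ , g′∈ , trans (turn-in g′∈) e
          ; β = β ; fits₁ = f₀ ; fits₂ = subst (λ e → FitsAt z e (not β)) (sym (turn-xs z∈)) f₁ }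

    -- Depth-first search.

    extend-↭ : ∀ U₁ s U₂ (R : List V) → (U₁ ++ s ∷ U₂) ++ R ↭ (U₁ ++ U₂) ++ s ∷ R
    extend-↭ U₁ s U₂ R = ↭-trans (++⁺ʳ R (shift s U₁ U₂)) (↭-sym (shift s (U₁ ++ U₂) R))

    retract-↭ : ∀ U xs s ys (H Z : List V) →
                U ++ (xs ++ s ∷ ys) ++ H ++ Z ↭ U ++ ys ++ (s ∷ H) ++ xs ++ Z
    retract-↭ U xs s ys H Z = ++⁺ˡ U (↭-trans (++⁺ʳ (H ++ Z) (shift s xs ys))
      (↭-trans (Perm.prep s (↭-trans (++-assoc xs ys (H ++ Z)) (↭-trans (shifts xs ys) (++⁺ˡ ys (shifts xs H)))))
               (↭-sym (shift s ys (H ++ xs ++ Z)))))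

    -- U: not yet visited, P: search path, H: closed, Z: dead.
    search : ∀ fuel U P H Z → 2 * length U + length P < fuel → Path P →
             Unique (U ++ P ++ H ++ Z) → (∀ {g} → g ∈ U ++ P ++ H ++ Z → IsSlotAt g) →
             (∀ {g} → IsSlotAt g → g ∈ U ++ P ++ H ++ Z) →
             (∀ {z} → z ∈ Z → Alt (H ++ Z) z) → 2 * length H ≤ length Z → Rainbow
    search zero U P H Z () _ _ _ _ _ _
    search (suc fuel) U P H Z (s≤s m≤) path uniq slots all alts 2H≤Z = go
      where
      open ≤-Reasoning
      σ = path-state path
      c = miss P
      uniq₂ = proj₁ (proj₂ (Unique-++⁻ U uniq))
      U∩ = λ {g} → proj₂ (proj₂ (Unique-++⁻ U uniq)) {g}
      uniq₃ = proj₁ (proj₂ (Unique-++⁻ P uniq₂))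
      P∩ = λ {g} → proj₂ (proj₂ (Unique-++⁻ P uniq₂)) {g}
      uniqZ = proj₁ (proj₂ (Unique-++⁻ H uniq₃))
      slots-Fn : ∀ {g} → g ∈ H ++ Z → IsSlotAt g
      slots-Fn = slots ∘ ∈-++⁺ʳ U ∘ ∈-++⁺ʳ P

      -- Moving a gadget from `U` to the path lowers `2 * length U + length P` by 1.
      grow : ∀ {s} → s ∈ U → Full c s → Rainbow
      grow {s} s∈ full with ∈-∃++ s∈
      ... | U₁ , U₂ , refl with fits₀ s (slots (∈-++⁺ˡ s∈))
      ...   | β , f₀ with full-fits (kind s) (local-win σ s) full
                            (subst (λ e → FitsAt s e β) (sym (off-path P (λ s∈P → U∩ s∈ (∈-++⁺ˡ s∈P)))) f₀)
      ...     | inj₁ r = r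
      ...     | inj₂ f₁ = search fuel (U₁ ++ U₂) (s ∷ P) H Z smaller
                  (cons β (λ s∈P → U∩ s∈ (∈-++⁺ˡ s∈P)) f₀ f₁ path)
                  (Unique-resp-↭ perm uniq) (slots ∘ ∈-resp-↭ (↭-sym perm)) (∈-resp-↭ perm ∘ all) alts 2H≤Z
        where
        perm = extend-↭ U₁ s U₂ (P ++ H ++ Z)
        len : length (U₁ ++ s ∷ U₂) ≡ suc (length (U₁ ++ U₂))
        len = trans (length-++ U₁) (trans (+-suc (length U₁) (length U₂)) (cong suc (sym (length-++ U₁))))
        smaller : 2 * length (U₁ ++ U₂) + length (s ∷ P) < fuel
        smaller = begin
          suc (2 * length (U₁ ++ U₂) + suc (length P))    ≡⟨ solve 2 (λ k p → con 1 :+ (con 2 :* k :+ (con 1 :+ p)) := con 2 :* (con 1 :+ k) :+ p) refl (length (U₁ ++ U₂)) (length P) ⟩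
          2 * suc (length (U₁ ++ U₂)) + length P          ≡⟨ cong (λ k → 2 * k + length P) (sym len) ⟩
          2 * length (U₁ ++ s ∷ U₂) + length P            ≤⟨ m≤ ⟩
          fuel                                            ∎
          where open +-*-Solver

      -- Since `p₁` and `p₂` come after `s`, closing `s` adds at least two dead gadgets, which
      -- preserves `2 * length H ≤ length Z`.
      retract : ∀ {p₁ p₂ ps s} → P ≡ p₁ ∷ p₂ ∷ ps → s ∈ ps → Full c s → Rainbow
      retract {p₁} {p₂} {s = s} refl s∈ full with ∈-∃++ s∈
      ... | xs′ , ys , refl with on-path path (there (there s∈))
      ...   | β , _ , f with full-fits (kind s) (local-win σ s) full f
      ...     | inj₁ r = r
      ...     | inj₂ f₁ = search fuel U ys (s ∷ H) (xs ++ Z) smaller (suffix (s ∷ []) (suffix xs path))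
                  (Unique-resp-↭ perm uniq) (slots ∘ ∈-resp-↭ (↭-sym perm)) (∈-resp-↭ perm ∘ all) alts′ enough
        where
        xs = p₁ ∷ p₂ ∷ xs′
        perm = retract-↭ U xs s ys H Z
        s∉xs : s ∉ xs
        s∉xs s∈xs = proj₂ (proj₂ (Unique-++⁻ xs (proj₁ (Unique-++⁻ P uniq₂)))) s∈xs (here refl)
        smaller : 2 * length U + length ys < fuel
        smaller = begin
          suc (2 * length U + length ys)       ≡⟨ sym (+-suc (2 * length U) (length ys)) ⟩
          2 * length U + length (s ∷ ys)       ≤⟨ +-monoʳ-≤ (2 * length U) (m≤n+m (length (s ∷ ys)) (length xs)) ⟩
          2 * length U + (length xs + length (s ∷ ys)) ≡⟨ cong (2 * length U +_) (sym (length-++ xs)) ⟩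
          2 * length U + length P              ≤⟨ m≤ ⟩
          fuel                                 ∎
        new : ∀ {g} → g ∈ s ∷ xs → g ∈ (s ∷ H) ++ xs ++ Z
        new (here refl) = here refl
        new (there g∈)  = ∈-++⁺ʳ (s ∷ H) (∈-++⁺ˡ g∈)
        old : ∀ {g} → g ∈ H ++ Z → g ∈ (s ∷ H) ++ xs ++ Z
        old g∈ with ∈-++⁻ H g∈
        ... | inj₁ g∈H = there (∈-++⁺ˡ g∈H)
        ... | inj₂ g∈Z = ∈-++⁺ʳ (s ∷ H) (∈-++⁺ʳ xs g∈Z)
        alts′ : ∀ {z} → z ∈ xs ++ Z → Alt ((s ∷ H) ++ xs ++ Z) z
        alts′ z∈ with ∈-++⁻ xs z∈
        ... | inj₁ z∈xs = widen new (turn-alt path s∉xs (_ , f₁) z∈xs)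
        ... | inj₂ z∈Z  = widen old (alts z∈Z)
        enough : 2 * length (s ∷ H) ≤ length (xs ++ Z)
        enough = begin
          2 * suc (length H)             ≡⟨ *-suc 2 (length H) ⟩
          2 + 2 * length H               ≤⟨ +-mono-≤ (s≤s (s≤s z≤n)) 2H≤Z ⟩
          length xs + length Z           ≡⟨ sym (length-++ xs) ⟩
          length (xs ++ Z)               ∎

      -- There are at most `2 + length H` full gadgets, so `10 + length Z` would be at most
      -- `4 + 2 * length H`, hence at most `4 + length Z`.
      stuck : ∀ ps → length ps ≤ 2 → 10 + length Z ≤ 2 * length (filter (Full? c) vs) →
              (∀ {g} → Full c g → g ∈ ps ++ H) → Rainbow
      stuck ps len count only = ⊥-elim (<⇒≱ (s≤s (s≤s (s≤s (s≤s (s≤s z≤n))))) (+-cancelʳ-≤ (length Z) 10 4 (begin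
        10 + length Z                          ≤⟨ count ⟩
        2 * length (filter (Full? c) vs)       ≤⟨ *-monoʳ-≤ 2 (length-⊆ (filter⁺ (Full? c) vs-unique) (λ g∈ → only (proj₂ (∈-filter⁻ (Full? c) {xs = vs} g∈)))) ⟩
        2 * length (ps ++ H)                   ≡⟨ cong (2 *_) (length-++ ps) ⟩
        2 * (length ps + length H)             ≡⟨ *-distribˡ-+ 2 (length ps) (length H) ⟩
        2 * length ps + 2 * length H           ≤⟨ +-mono-≤ (*-monoʳ-≤ 2 len) 2H≤Z ⟩
        4 + length Z                           ∎)))

      go : Rainbow
      -- Deadness refers to the missing colour, which changes with the path; it is derived anew from
      -- the stored rearrangements.
      go with scan IH (fill σ) | collect Z (λ z∈ → alt-dead path P∩ slots-Fn (alts z∈) (∈-++⁺ʳ H z∈))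
      ... | inj₁ r | _ = r
      ... | inj₂ _ | inj₁ r = r
      ... | inj₂ clean | inj₂ dead with Any.any? (Full? c) U
      ...   | yes any = let s , s∈ , full = find any in grow s∈ full
      ...   | no ¬U = cases P refl
        where
        count = full-count clean (members (fill σ)) uniqZ dead
        where-full : ∀ {g} → Full c g → g ∈ P ⊎ g ∈ H
        where-full {g} full with ∈-++⁻ U (all (full-slot full))
        ... | inj₁ g∈U = ⊥-elim (¬U (lose g∈U full))
        ... | inj₂ g∈ with ∈-++⁻ P g∈
        ...   | inj₁ g∈P = inj₁ g∈P
        ...   | inj₂ g∈HZ with ∈-++⁻ H g∈HZ
        ...     | inj₁ g∈H = inj₂ g∈H
        ...     | inj₂ g∈Z = ⊥-elim (Dead.out₁ (dead g∈Z) (proj₂ full (Dead.In₁ (dead g∈Z))))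
        short : length P ≤ 2 → Rainbow
        short len = stuck P len count λ full → [ ∈-++⁺ˡ , ∈-++⁺ʳ P ]′ (where-full full)
        cases : ∀ P′ → P ≡ P′ → Rainbow
        cases []           refl = short z≤n
        cases (_ ∷ [])     refl = short (s≤s z≤n)
        cases (p₁ ∷ p₂ ∷ ps) eq with Any.any? (Full? c) ps
        ... | yes any = let s , s∈ , full = find any in retract eq s∈ full
        ... | no ¬ps = stuck (p₁ ∷ p₂ ∷ []) ≤-refl count λ full → near full (where-full full)
          where
          near : ∀ {g} → Full c g → g ∈ P ⊎ g ∈ H → g ∈ p₁ ∷ p₂ ∷ H
          near full (inj₂ g∈H) = there (there g∈H)
          near full (inj₁ g∈P) with subst (_ ∈_) eq g∈P
          ... | here e              = here e
          ... | there (here e)      = there (here e)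
          ... | there (there g∈ps)  = ⊥-elim (¬ps (lose g∈ps full))

    -- The search starts with all nontrivial gadgets in `U`; a single vertex is never full, by
    -- `full-slot`.
    found : Rainbow
    found = search _ U [] [] [] ≤-refl [] (subst Unique (sym eq) (filter⁺ slot? vs-unique))
      (λ g∈ → proj₂ (∈-filter⁻ slot? {xs = vs} (subst (_ ∈_) eq g∈)))
      (λ {g} s → subst (g ∈_) (sym eq) (∈-filter⁺ slot? (vs-all g) s)) (λ ()) z≤n
      where
      slot? : ∀ g → Dec (IsSlotAt g)
      slot? g with kind g
      ... | inj₁ _ = no λ ()
      ... | inj₂ _ = yes tt
      U = filter slot? vs
      eq : U ++ [] ≡ U
      eq = ++-identityʳ U

  solve-from : ∀ fuel {B} → Fill B → Base.outs B < fuel → Rainbow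
  solve-from (suc fuel) F (s≤s o≤) = Search.found F λ B′ F′ lt → solve-from fuel F′ (≤-trans lt o≤)

-- Induction on the number of colours.

module _ (V : Set) (_≟_ : DecidableEquality V) (vs : List V) (vs-all : ∀ v → v ∈ vs) (vs-unique : Unique vs)
         (side : V → Bool) where

  rainbow : ∀ n (mate : Fin n → V → Maybe V) →
            (∀ {i u v} → mate i u ≡ just v → mate i v ≡ just u) →
            (∀ {i u v} → mate i u ≡ just v → side v ≡ not (side u)) →
            (es : Fin n → List (V × V)) →
            (∀ {i e} → e ∈ es i → mate i (proj₁ e) ≡ just (proj₂ e)) →
            (∀ i → Unique (concatMap (λ e → proj₁ e ∷ proj₂ e ∷ []) (es i))) →
            (∀ i → 3 * n + 2 ≤ 2 * length (es i)) →
            Σ (Fin n → V × V) λ e →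
              (∀ i → mate i (proj₁ (e i)) ≡ just (proj₂ (e i))) × (∀ i j → i ≢ j → Disj (e i) (e j))
  rainbow zero _ _ _ _ _ _ _ = (λ ()) , (λ ()) , λ ()
  rainbow (suc n) mate mate-sym mate-side es es-joined es-unique es-size = solve-from _ start ≤-refl
    where
    open Core V _≟_ vs vs-all vs-unique side (suc n) mate mate-sym mate-side es es-joined es-unique es-size
    -- Colour `zero` is set aside and becomes the first missing colour.
    IH = rainbow n (mate ∘ suc) mate-sym mate-side (es ∘ suc) es-joined (es-unique ∘ suc)
           (λ i → ≤-trans (+-monoˡ-≤ 2 (*-monoʳ-≤ 3 (n≤1+n n))) (es-size (suc i)))
    e = proj₁ IH
    e-joined = proj₁ (proj₂ IH)
    e-apart = proj₂ (proj₂ IH)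

    on? : ∀ v → Dec (∃ λ i → v ≡ proj₁ (e i) ⊎ v ≡ proj₂ (e i))
    on? v = any? λ i → (v ≟ proj₁ (e i)) ⊎-dec (v ≟ proj₂ (e i))

    label : ∀ v → Dec (∃ λ i → v ≡ proj₁ (e i) ⊎ v ≡ proj₂ (e i)) → V ⊎ Fin (suc n)
    label v (yes (i , _)) = inj₂ (suc i)
    label v (no _)        = inj₁ v

    same : ∀ {v i j} → v ≡ proj₁ (e i) ⊎ v ≡ proj₂ (e i) → v ≡ proj₁ (e j) ⊎ v ≡ proj₂ (e j) → i ≡ j
    same {v} {i} {j} vi vj with i ≟ᶠ j
    ... | yes eq = eq
    ... | no i≢j with e-apart i j i≢j | vi | vj
    ...   | (p , _) , _ | inj₁ a | inj₁ b = ⊥-elim (p (trans (sym a) b))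
    ...   | (_ , p) , _ | inj₁ a | inj₂ b = ⊥-elim (p (trans (sym a) b))
    ...   | _ , (p , _) | inj₂ a | inj₁ b = ⊥-elim (p (trans (sym a) b))
    ...   | _ , (_ , p) | inj₂ a | inj₂ b = ⊥-elim (p (trans (sym a) b))

    label-on : ∀ {v i} → v ≡ proj₁ (e i) ⊎ v ≡ proj₂ (e i) → ∀ d → label v d ≡ inj₂ (suc i)
    label-on vi (yes (j , vj)) = cong (inj₂ ∘ suc) (same vj vi)
    label-on vi (no ¬on)       = ⊥-elim (¬on (_ , vi))

    label-free : ∀ {v g} d → label v d ≡ inj₁ g → v ≡ g
    label-free (no _) refl = refl

    first : (xs : List (V × V)) → 3 * suc n + 2 ≤ 2 * length xs → V
    first ((u , _) ∷ _) _ = u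

    end₁ end₂ : Fin (suc n) → V
    -- A default value: `out zero` is `false`, so `Base` demands nothing of this end. The list
    -- `es zero` is nonempty by its size.
    end₁ zero    = first (es zero) (es-size zero)
    end₁ (suc i) = proj₁ (e i)
    end₂ zero    = first (es zero) (es-size zero)
    end₂ (suc i) = proj₂ (e i)

    out : Fin (suc n) → Bool
    out zero    = false
    out (suc _) = true

    label-out : ∀ {v j} d → label v d ≡ inj₂ j → out j ≡ true × (v ≡ end₁ j ⊎ v ≡ end₂ j)
    label-out (yes (i , vi)) refl = refl , vi

    outs≤ : Σ[ allFin (suc n) ] (λ j → if out j then 1 else 0) ≤ n
    outs≤ = begin
      Σ[ others ] (λ j → if out j then 1 else 0)   ≤⟨ Σ-mono others (λ {j} _ → ≤1 (out j)) ⟩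
      Σ[ others ] (const 1)                        ≡⟨ trans (Σ-const others 1) (*-identityˡ _) ⟩
      length others                                ≡⟨ length-tabulate suc ⟩
      n                                            ∎
      where
      open ≤-Reasoning
      others : List (Fin (suc n))
      others = tabulate suc
      ≤1 : ∀ b → (if b then 1 else 0) ≤ 1
      ≤1 true  = ≤-refl
      ≤1 false = z≤n

    base : Base
    base = record
      { lab = λ v → label v (on? v) ; a = end₁ ; b = end₂ ; out = out ; h = const 0
      ; lab-out = λ {v} → label-out (on? v)
      ; lab-a = λ { {suc i} _ → label-on (inj₁ refl) (on? _) }
      ; lab-b = λ { {suc i} _ → label-on (inj₂ refl) (on? _) }
      ; out-edge = λ { {suc i} _ → e-joined i }
      ; total = s≤s (+-mono-≤ (≤-reflexive (Σ-const vs 0)) outs≤) }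

    start : Fill base
    start = record
      { c = zero ; Γ = λ _ _ → ⊥
      ; gad = λ g → single (λ {u} {v} s t → trans (label-free (on? u) s) (sym (label-free (on? v) t))) (λ ())
      ; cov = λ { zero → inj₁ refl ; (suc _) → inj₂ (inj₁ refl) } }

-- Lists of disjoint edges as partial involutions.

module _ {p q : ℕ} where

  right : List (Edge p q) → Fin p → Maybe (Fin q)
  right []            x = nothing
  right ((x′ , y) ∷ M) x = if does (x ≟ᶠ x′) then just y else right M x

  left : List (Edge p q) → Fin q → Maybe (Fin p)
  left []            y = nothing
  left ((x , y′) ∷ M) y = if does (y ≟ᶠ y′) then just x else left M y

  right-∈ : ∀ M {x y} → right M x ≡ just y → (x , y) ∈ M
  right-∈ ((x′ , y′) ∷ M) {x} eq with x ≟ᶠ x′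
  right-∈ ((x′ , y′) ∷ M) refl | yes refl = here refl
  right-∈ ((x′ , y′) ∷ M) eq   | no _     = there (right-∈ M eq)

  left-∈ : ∀ M {x y} → left M y ≡ just x → (x , y) ∈ M
  left-∈ ((x′ , y′) ∷ M) {y = y} eq with y ≟ᶠ y′
  left-∈ ((x′ , y′) ∷ M) refl | yes refl = here refl
  left-∈ ((x′ , y′) ∷ M) eq   | no _     = there (left-∈ M eq)

  ∈-right : ∀ {M x y} → AllPairs Disjoint M → (x , y) ∈ M → right M x ≡ just y
  ∈-right {_ ∷ _} {x} _ (here refl) = if-yes (x ≟ᶠ x) refl
  ∈-right {(x′ , _) ∷ _} {x} (d ∷ ds) (there e∈) =
    trans (if-no (x ≟ᶠ x′) (proj₁ (All.lookup d e∈) ∘ sym)) (∈-right ds e∈)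

  ∈-left : ∀ {M x y} → AllPairs Disjoint M → (x , y) ∈ M → left M y ≡ just x
  ∈-left {_ ∷ _} {y = y} _ (here refl) = if-yes (y ≟ᶠ y) refl
  ∈-left {(_ , y′) ∷ _} {y = y} (d ∷ ds) (there e∈) =
    trans (if-no (y ≟ᶠ y′) (proj₂ (All.lookup d e∈) ∘ sym)) (∈-left ds e∈)

  Vertex : Set
  Vertex = Fin p ⊎ Fin q

  pair : Edge p q → Vertex × Vertex
  pair (x , y) = inj₁ x , inj₂ y

  mate-of : List (Edge p q) → Vertex → Maybe Vertex
  mate-of M (inj₁ x) = Maybe.map inj₂ (right M x)
  mate-of M (inj₂ y) = Maybe.map inj₁ (left M y)

  -- The orientation is recorded because `mate-of` may traverse an edge from either side; `edge-of`
  -- then recovers the edge of the list.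
  data Joins (M : List (Edge p q)) : Vertex → Vertex → Set where
    →ʳ : ∀ {x y} → (x , y) ∈ M → Joins M (inj₁ x) (inj₂ y)
    →ˡ : ∀ {x y} → (x , y) ∈ M → Joins M (inj₂ y) (inj₁ x)

  mate-joins : ∀ M {u v} → mate-of M u ≡ just v → Joins M u v
  mate-joins M {inj₁ x} eq with right M x in r
  mate-joins M {inj₁ x} refl | just y = →ʳ (right-∈ M r)
  mate-joins M {inj₂ y} eq with left M y in l
  mate-joins M {inj₂ y} refl | just x = →ˡ (left-∈ M l)

  joins-mate : ∀ {M u v} → AllPairs Disjoint M → Joins M u v → mate-of M u ≡ just v
  joins-mate ds (→ʳ e∈) = cong (Maybe.map inj₂) (∈-right ds e∈)
  joins-mate ds (→ˡ e∈) = cong (Maybe.map inj₁) (∈-left ds e∈)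

  joins-sym : ∀ {M u v} → Joins M u v → Joins M v u
  joins-sym (→ʳ e∈) = →ˡ e∈
  joins-sym (→ˡ e∈) = →ʳ e∈

  is-left : Vertex → Bool
  is-left = [ const true , const false ]′

  joins-side : ∀ {M u v} → Joins M u v → is-left v ≡ not (is-left u)
  joins-side (→ʳ _) = refl
  joins-side (→ˡ _) = refl

  ends-unique : ∀ {M} → AllPairs Disjoint M → Unique (concatMap (λ e → proj₁ e ∷ proj₂ e ∷ []) (map pair M))
  ends-unique [] = []
  ends-unique {(x , y) ∷ M} (d ∷ ds) = ((λ ()) ∷ fresh M d proj₁≢) ∷ fresh M d proj₂≢ ∷ ends-unique ds
    where
    fresh : ∀ M {v} → All (Disjoint (x , y)) M →
            (∀ {e} → Disjoint (x , y) e → v ≢ proj₁ (pair e) × v ≢ proj₂ (pair e)) →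
            All (v ≢_) (concatMap (λ e → proj₁ e ∷ proj₂ e ∷ []) (map pair M))
    fresh []      []       f = []
    fresh (e ∷ M) (d ∷ ds) f = proj₁ (f d) ∷ proj₂ (f d) ∷ fresh M ds f
    proj₁≢ : ∀ {e} → Disjoint (x , y) e → inj₁ x ≢ proj₁ (pair e) × inj₁ x ≢ proj₂ (pair e)
    proj₁≢ d = (λ eq → proj₁ d (inj₁-injective eq)) , λ ()
    proj₂≢ : ∀ {e} → Disjoint (x , y) e → inj₂ y ≢ proj₁ (pair e) × inj₂ y ≢ proj₂ (pair e)
    proj₂≢ d = (λ ()) , λ eq → proj₂ d (inj₂-injective eq)

  vertex-list : List Vertex
  vertex-list = map inj₁ (allFin p) ++ map inj₂ (allFin q)

  vertex-all : ∀ v → v ∈ vertex-list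
  vertex-all (inj₁ x) = ∈-++⁺ˡ (∈-map⁺ inj₁ (∈-allFin x))
  vertex-all (inj₂ y) = ∈-++⁺ʳ (map inj₁ (allFin p)) (∈-map⁺ inj₂ (∈-allFin y))

  vertex-unique : Unique vertex-list
  vertex-unique = ++⁺ (map⁺ inj₁-injective (allFin⁺ p)) (map⁺ inj₂-injective (allFin⁺ q)) disjoint
    where
    disjoint : ∀ {v} → ¬ (v ∈ map inj₁ (allFin p) × v ∈ map inj₂ (allFin q))
    disjoint (v∈₁ , v∈₂) with ∈-map⁻ inj₁ v∈₁ | ∈-map⁻ inj₂ v∈₂
    ... | _ , _ , refl | _ , _ , ()

  edge-of : ∀ {M u v} → Joins M u v → Edge p q
  edge-of (→ʳ {x} {y} _) = x , y
  edge-of (→ˡ {x} {y} _) = x , y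

  edge-of-∈ : ∀ {M u v} (j : Joins M u v) → edge-of j ∈ M
  edge-of-∈ (→ʳ e∈) = e∈
  edge-of-∈ (→ˡ e∈) = e∈

  edge-of-disjoint : ∀ {M M′ u v u′ v′} (j : Joins M u v) (j′ : Joins M′ u′ v′) →
                     Disj (u , v) (u′ , v′) → Disjoint (edge-of j) (edge-of j′)
  edge-of-disjoint (→ʳ _) (→ʳ _) ((d , _) , (_ , d′)) = d ∘ cong inj₁ , d′ ∘ cong inj₂
  edge-of-disjoint (→ʳ _) (→ˡ _) ((_ , d) , (d′ , _)) = d ∘ cong inj₁ , d′ ∘ cong inj₂
  edge-of-disjoint (→ˡ _) (→ʳ _) ((_ , d′) , (d , _)) = d ∘ cong inj₁ , d′ ∘ cong inj₂
  edge-of-disjoint (→ˡ _) (→ˡ _) ((d′ , _) , (_ , d)) = d ∘ cong inj₁ , d′ ∘ cong inj₂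

-- Transfer to the bipartite graph.

n≤2*⌈n/2⌉ : ∀ n → n ≤ 2 * ⌈ n /2⌉
n≤2*⌈n/2⌉ n = begin
  n                       ≡⟨ sym (⌊n/2⌋+⌈n/2⌉≡n n) ⟩
  ⌊ n /2⌋ + ⌈ n /2⌉       ≤⟨ +-monoˡ-≤ ⌈ n /2⌉ (⌊n/2⌋≤⌈n/2⌉ n) ⟩
  ⌈ n /2⌉ + ⌈ n /2⌉       ≡⟨ cong (⌈ n /2⌉ +_) (sym (+-identityʳ _)) ⟩
  2 * ⌈ n /2⌉             ∎
  where open ≤-Reasoning

theorem2 : (n : ℕ) → 1 ≤ n → (p q : ℕ) → (G : BipGraph p q)
    → (F : Fin n → List (Edge p q))
    → ((i : Fin n) → IsMatching G (F i))
    → ((i : Fin n) → ⌈ 3 * n /2⌉ + 1 ≤ length (F i))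
    → Σ (Fin n → Edge p q) (λ e →
    ((i : Fin n) → e i ∈ F i)
    × ((i j : Fin n) → i ≢ j → Disjoint (e i) (e j)))
theorem2 n _ p q G F matching size =
  (λ i → edge-of (joins i)) , (λ i → edge-of-∈ (joins i)) ,
  λ i j i≢j → edge-of-disjoint (joins i) (joins j) (apart i j i≢j)
  where
  disjoint : ∀ i → AllPairs Disjoint (F i)
  disjoint i = proj₂ (matching i)

  -- Doubling `⌈ 3 * n /2⌉ + 1` removes the rounding and gives the form used in the weight count.
  large : ∀ i → 3 * n + 2 ≤ 2 * length (map pair (F i))
  large i = begin
    3 * n + 2                       ≤⟨ +-monoˡ-≤ 2 (n≤2*⌈n/2⌉ (3 * n)) ⟩
    2 * ⌈ 3 * n /2⌉ + 2             ≡⟨ sym (*-distribˡ-+ 2 ⌈ 3 * n /2⌉ 1) ⟩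
    2 * (⌈ 3 * n /2⌉ + 1)           ≤⟨ *-monoʳ-≤ 2 (size i) ⟩
    2 * length (F i)                ≡⟨ cong (2 *_) (sym (length-map pair (F i))) ⟩
    2 * length (map pair (F i))     ∎
    where open ≤-Reasoning

  joined : ∀ {i e} → e ∈ map pair (F i) → mate-of (F i) (proj₁ e) ≡ just (proj₂ e)
  joined {i} e∈ with ∈-map⁻ pair e∈
  ... | _ , e∈F , refl = joins-mate (disjoint i) (→ʳ e∈F)

  result = rainbow Vertex (≡-dec _≟ᶠ_ _≟ᶠ_) vertex-list vertex-all vertex-unique is-left n
    (λ i → mate-of (F i))
    (λ {i} uv → joins-mate (disjoint i) (joins-sym (mate-joins (F i) uv)))
    (λ {i} {u} uv → joins-side (mate-joins (F i) {u} uv))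
    (λ i → map pair (F i)) (λ {i} → joined {i}) (λ i → ends-unique (disjoint i)) large

  joins : ∀ i → Joins (F i) _ _
  joins i = mate-joins (F i) (proj₁ (proj₂ result) i)

  apart = proj₂ (proj₂ result)
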